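{- E-E-Reach[$Z_1^{\mathtt l}$] reduces to $\mathsf{PEP}^{\mathrm{partial}}_{\mathrm{codir}}$ (via a polynomial many-one reduction).
   Context: A UCST (unidirectional channel system with tests) is a tuple $S=(\{\mathtt r,\mathtt l\},M,Q_1,\Delta_1,Q_2,\Delta_2)$ where $M$ is a finite message alphabet, $Q_1,Q_2$ are disjoint finite sets of states of Sender and Receiver respectively, and $\Delta_1,\Delta_2$ are finite sets of rules of Sender and Receiver. There are two channels: $\mathtt r$ (reliable) and $\mathtt l$ (lossy). A rule in $\Delta_i$ is a tuple $(q,\mathtt c,\alpha,q')\in Q_i\times\{\mathtt r,\mathtt l\}\times \mathrm{Act}\times Q_i$ with $\mathrm{Act}=\mathrm{Reg}(M)\cup M\cup\{\epsilon\}$, where $\mathrm{Reg}(M)$ is the set of regular languages over $M$ (finitely represented, e.g. by finite automata or regular expressions). If $\alpha=R\in\mathrm{Reg}(M)$ the rule is a test on $\mathtt c$; if $\alpha=x\in M\cup\{\epsilon\}$ it is a write $\mathtt c!x$ when in $\Delta_1$ and a read $\mathtt c?x$ when in $\Delta_2$ ($\alpha=\epsilon$ is the empty action). Configurations are tuples $(q_1,q_2,u,v)\in Q_1\times Q_2\times M^*\times M^*$ ($u$ is the content of $\mathtt r$, $v$ that of $\mathtt l$). Reliable steps: a rule $(q,\mathtt c,\alpha,q')$ of Sender (respectively Receiver) can be fired if $q$ is the current Sender (respectively Receiver) state, which becomes $q'$, the other agent's state being unchanged; a test $R$ on $\mathtt c$ requires the content of $\mathtt c$ to be in $R$ and changes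 no content; a write $\mathtt c!x$ appends $x$ at the right end of the content of $\mathtt c$; a read $\mathtt c?x$ requires $x$ to be a prefix of the content of $\mathtt c$ and removes it. Loss steps: $(q_1,q_2,u,v)\to(q_1,q_2,u,v')$ whenever $v'$ is obtained from $v$ by deleting one occurrence of a symbol. A step is a reliable step or a loss step; a run $C\xrightarrow{*}D$ is a finite sequence of chained steps. E-E-Reach[$Z_1^{\mathtt l}$]: given a UCST $S$ whose only tests are emptiness tests $Z=\{\epsilon\}$ performed by Sender on channel $\mathtt l$, and states $p_{\mathrm{in}},p_{\mathrm{fi}}\in Q_1$, $q_{\mathrm{in}},q_{\mathrm{fi}}\in Q_2$, is there a run $(p_{\mathrm{in}},q_{\mathrm{in}},\epsilon,\epsilon)\xrightarrow{*}(p_{\mathrm{fi}},q_{\mathrm{fi}},\epsilon,\epsilon)$? $\mathsf{PEP}^{\mathrm{partial}}_{\mathrm{codir}}$ (Post embedding with partial codirectness): given two finite alphabets $\Sigma,\Gamma$, two morphisms $u,v:\Sigma^*\to\Gamma^*$, and two regular languages $R,R'\in\mathrm{Reg}(\Sigma)$, is there $\sigma\in R$ such that $u(\sigma)\sqsubseteq v(\sigma)$ and such that furthermore $u(\sigma')\sqsubseteq v(\sigma')$ for all suffixes $\sigma'$ of $\sigma$ that belong to $R'$? Here $\sqsubseteq$ is the (scattered) subword relation: $x\sqsubseteq y$ iff $x$ is obtained from $y$ by deleting some (possibly zero) occurrences of symbols. -}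

module Defs where

open import Data.Nat.Base using (ℕ; zero; suc; _+_; _*_; _^_; _≤_)
open import Data.Fin.Base using (Fin; toℕ)
open import Data.List.Base using (List; []; _∷_; _++_; [_]; concatMap)
open import Data.List.Membership.Propositional using (_∈_)
open import Data.List.Relation.Binary.Sublist.Propositional using (_⊆_)
open import Data.List.Relation.Binary.Suffix.Heterogeneous using (Suffix)
open import Data.Product.Base using (_×_; _,_; Σ-syntax; ∃-syntax)
open import Data.Vec.Base using (Vec; lookup; toList)
open import Function.Bundles using (_⇔_)
open import Relation.Binary.Construct.Closure.ReflexiveTransitive using (Star)
open import Relation.Binary.PropositionalEquality.Core using (_≡_)
open import Relation.Nullary.Negation.Core using (¬_)

-- A finite alphabet with k letters is Fin k.  Regular languages are
-- represented by nondeterministic finite automata without ε-moves.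

Word : ℕ → Set
Word k = List (Fin k)

record NFA (k : ℕ) : Set where
  field
    states  : ℕ
    initial : List (Fin states)
    final   : List (Fin states)
    trans   : List (Fin states × Fin k × Fin states)

module _ {k : ℕ} (A : NFA k) where
  open NFA A

  data Path : Fin states → Word k → Fin states → Set where
    []  : ∀ {p} → Path p [] p
    _∷_ : ∀ {p a q w r} → (p , a , q) ∈ trans → Path q w r → Path p (a ∷ w) r

infix 4 _∈L_

_∈L_ : ∀ {k} → Word k → NFA k → Set
w ∈L A = ∃[ p ] ∃[ q ] (p ∈ NFA.initial A × q ∈ NFA.final A × Path A p w q)

data Chan : Set where
  r l : Chan

data Act (m : ℕ) : Set where
  test : NFA m → Act m
  msg  : Fin m → Act m
  ε    : Act m

record Rule (n m : ℕ) : Set where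
  constructor rule
  field
    src  : Fin n
    chan : Chan
    act  : Act m
    dst  : Fin n

-- Q₁ and Q₂ are the distinct types Fin n₁ and Fin n₂, hence disjoint.

record UCST : Set where
  field
    m n₁ n₂ : ℕ
    Δ₁      : List (Rule n₁ m)
    Δ₂      : List (Rule n₂ m)

data Sends {m : ℕ} : Act m → Word m → Word m → Set where
  test  : ∀ {A w} → w ∈L A → Sends (test A) w w
  write : ∀ {x w} → Sends (msg x) w (w ++ [ x ])
  skip  : ∀ {w} → Sends ε w w

data Receives {m : ℕ} : Act m → Word m → Word m → Set where
  test : ∀ {A w} → w ∈L A → Receives (test A) w w
  read : ∀ {x w} → Receives (msg x) (x ∷ w) w
  skip : ∀ {w} → Receives ε w w

data Loses {m : ℕ} : Word m → Word m → Set where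
  here  : ∀ {x v} → Loses (x ∷ v) v
  there : ∀ {x v v′} → Loses v v′ → Loses (x ∷ v) (x ∷ v′)

-- Contents are pairs (u , v) with u on channel r and v on channel l.

On : ∀ {m} → Chan → (Word m → Word m → Set) →
     Word m × Word m → Word m × Word m → Set
On r E (u , v) (u′ , v′) = E u u′ × v′ ≡ v
On l E (u , v) (u′ , v′) = u′ ≡ u × E v v′

module _ (S : UCST) where
  open UCST S

  Config : Set
  Config = Fin n₁ × Fin n₂ × Word m × Word m

  data Step : Config → Config → Set where
    sender   : ∀ {p c α p′ q K K′} → rule p c α p′ ∈ Δ₁ →
               On c (Sends α) K K′ → Step (p , q , K) (p′ , q , K′)
    receiver : ∀ {p q c α q′ K K′} → rule q c α q′ ∈ Δ₂ →
               On c (Receives α) K K′ → Step (p , q , K) (p , q′ , K′)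
    loss     : ∀ {p q u v v′} → Loses v v′ →
               Step (p , q , u , v) (p , q , u , v′)

  Run : Config → Config → Set
  Run = Star Step

IsEmptinessTest : ∀ {m} → NFA m → Set
IsEmptinessTest A = ∀ w → (w ∈L A) ⇔ (w ≡ [])

record OnlyZ₁ˡ (S : UCST) : Set where
  open UCST S
  field
    tests₁ : ∀ {p c A p′} → rule p c (test A) p′ ∈ Δ₁ →
             c ≡ l × IsEmptinessTest A
    tests₂ : ∀ {q c A q′} → ¬ (rule q c (test A) q′ ∈ Δ₂)

record ReachInstance : Set where
  field
    S         : UCST
  open UCST S public
  field
    onlyZ₁ˡ   : OnlyZ₁ˡ S
    p-in p-fi : Fin n₁
    q-in q-fi : Fin n₂

E-E-Reachable : ReachInstance → Set
E-E-Reachable I = Run S (p-in , q-in , [] , []) (p-fi , q-fi , [] , [])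
  where open ReachInstance I

-- A morphism of free monoids, given by the images of the letters.

Morphism : ℕ → ℕ → Set
Morphism s g = Vec (Word g) s

infix 9 _⟪_⟫

_⟪_⟫ : ∀ {s g} → Morphism s g → Word s → Word g
h ⟪ σ ⟫ = concatMap (lookup h) σ

record PEPInstance : Set where
  field
    s g  : ℕ
    u v  : Morphism s g
    R R′ : NFA s

PEP-Solvable : PEPInstance → Set
PEP-Solvable I =
  ∃[ σ ] (σ ∈L R × u ⟪ σ ⟫ ⊆ v ⟪ σ ⟫ ×
          (∀ σ′ → Suffix _≡_ σ′ σ → σ′ ∈L R′ → u ⟪ σ′ ⟫ ⊆ v ⟪ σ′ ⟫))
  where open PEPInstance I

-- The model of polynomial-time computation is a WHILE language over binary
-- trees in the style of N. D. Jones (Computability and Complexity from a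
-- Programming Perspective).  Its programs are deterministic, possibly
-- diverging, transformations of a single tree.

data Tree : Set where
  leaf : Tree
  node : Tree → Tree → Tree

size : Tree → ℕ
size leaf       = 1
size (node a b) = suc (size a + size b)

infixr 9 _⨾_

data Prog : Set where
  id nil hd tl  : Prog
  cons          : Prog → Prog → Prog
  _⨾_           : Prog → Prog → Prog
  if_then_else_ : Prog → Prog → Prog → Prog
  while         : Prog → Prog → Prog

-- p ⊢ d ⇓ e [ t ]: on input d the program p halts with output e in time t.
-- A test succeeds when its value is not leaf.  Every construct is charged the
-- size of the tree it is applied to, rather than a unit cost.  As a result
-- size e ≤ t, so repeated duplication cannot build trees of exponential size
-- in polynomial time, and the time agrees with Turing machine time up to a
-- polynomial.

infix 4 _⊢_⇓_[_]

data _⊢_⇓_[_] : Prog → Tree → Tree → ℕ → Set where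
  id      : ∀ {d} → id ⊢ d ⇓ d [ size d ]
  nil     : ∀ {d} → nil ⊢ d ⇓ leaf [ size d ]
  hd-leaf : hd ⊢ leaf ⇓ leaf [ size leaf ]
  hd-node : ∀ {a b} → hd ⊢ node a b ⇓ a [ size (node a b) ]
  tl-leaf : tl ⊢ leaf ⇓ leaf [ size leaf ]
  tl-node : ∀ {a b} → tl ⊢ node a b ⇓ b [ size (node a b) ]
  cons    : ∀ {p q d a b i j} →
            p ⊢ d ⇓ a [ i ] → q ⊢ d ⇓ b [ j ] →
            cons p q ⊢ d ⇓ node a b [ size d + i + j ]
  seq     : ∀ {p q d e f i j} →
            p ⊢ d ⇓ e [ i ] → q ⊢ e ⇓ f [ j ] →
            p ⨾ q ⊢ d ⇓ f [ size d + i + j ]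
  if-yes  : ∀ {c p q d a b e i j} →
            c ⊢ d ⇓ node a b [ i ] → p ⊢ d ⇓ e [ j ] →
            if c then p else q ⊢ d ⇓ e [ size d + i + j ]
  if-no   : ∀ {c p q d e i j} →
            c ⊢ d ⇓ leaf [ i ] → q ⊢ d ⇓ e [ j ] →
            if c then p else q ⊢ d ⇓ e [ size d + i + j ]
  stop    : ∀ {c p d i} →
            c ⊢ d ⇓ leaf [ i ] →
            while c p ⊢ d ⇓ d [ size d + i ]
  loop    : ∀ {c p d a b e f i j k} →
            c ⊢ d ⇓ node a b [ i ] → p ⊢ d ⇓ e [ j ] →
            while c p ⊢ e ⇓ f [ k ] →
            while c p ⊢ d ⇓ f [ size d + i + j + k ]

record Problem : Set₁ where
  field
    Instance : Set
    encode   : Instance → Tree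
    Yes      : Instance → Set

module _ (P Q : Problem) where
  private
    module P = Problem P
    module Q = Problem Q

  -- Every polynomial is bounded by some k * n ^ k + k.

  PolyTime : (P.Instance → Q.Instance) → Set
  PolyTime f =
    Σ[ p ∈ Prog ] Σ[ k ∈ ℕ ] ∀ x →
      ∃[ t ] (p ⊢ P.encode x ⇓ Q.encode (f x) [ t ]
              × t ≤ k * size (P.encode x) ^ k + k)

  PolyReducible : Set
  PolyReducible =
    Σ[ f ∈ (P.Instance → Q.Instance) ]
      (PolyTime f × (∀ x → P.Yes x ⇔ Q.Yes (f x)))

-- States and letters are written in unary.  A set of n states or letters
-- counts as an input of size at least n, so this agrees with a binary
-- encoding up to a polynomial.

encℕ : ℕ → Tree
encℕ zero    = leaf
encℕ (suc n) = node leaf (encℕ n)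

encFin : ∀ {n} → Fin n → Tree
encFin i = encℕ (toℕ i)

encList : ∀ {A : Set} → (A → Tree) → List A → Tree
encList e []       = leaf
encList e (x ∷ xs) = node (e x) (encList e xs)

encWord : ∀ {k} → Word k → Tree
encWord = encList encFin

encNFA : ∀ {k} → NFA k → Tree
encNFA A =
  node (encℕ states)
  (node (encList encFin initial)
  (node (encList encFin final)
        (encList (λ (p , a , q) → node (encFin p) (node (encFin a) (encFin q)))
                 trans)))
  where open NFA A

encChan : Chan → Tree
encChan r = encℕ 0
encChan l = encℕ 1

encAct : ∀ {m} → Act m → Tree
encAct (test A) = node (encℕ 0) (encNFA A)
encAct (msg x)  = node (encℕ 1) (encFin x)
encAct ε        = node (encℕ 2) leaf

encRule : ∀ {n m} → Rule n m → Tree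
encRule (rule p c α p′) =
  node (encFin p) (node (encChan c) (node (encAct α) (encFin p′)))

encUCST : UCST → Tree
encUCST S =
  node (encℕ m)
  (node (encℕ n₁)
  (node (encℕ n₂)
  (node (encList encRule Δ₁)
        (encList encRule Δ₂))))
  where open UCST S

encReach : ReachInstance → Tree
encReach I =
  node (encUCST S)
  (node (encFin p-in)
  (node (encFin p-fi)
  (node (encFin q-in)
        (encFin q-fi))))
  where open ReachInstance I

encMorphism : ∀ {s g} → Morphism s g → Tree
encMorphism h = encList encWord (toList h)

encPEP : PEPInstance → Tree
encPEP I =
  node (encℕ s)
  (node (encℕ g)
  (node (encMorphism u)
  (node (encMorphism v)
  (node (encNFA R)
        (encNFA R′)))))
  where open PEPInstance I

E-E-Reach[Z₁ˡ] : Problem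
E-E-Reach[Z₁ˡ] = record
  { Instance = ReachInstance
  ; encode   = encReach
  ; Yes      = E-E-Reachable
  }

PEP-partial-codir : Problem
PEP-partial-codir = record
  { Instance = PEPInstance
  ; encode   = encPEP
  ; Yes      = PEP-Solvable
  }

{-# OPTIONS --safe #-}
module Submission where

-- The letters of the Post embedding instance are: a test, a silent move, and
-- for every message x, writing x to l and reading x from l.  The regular
-- language R is that of an automaton that runs both agents with a channel r of
-- capacity one, and R′ consists of the words starting with a test.  The images
-- under u and v are the words read from and written to l.
--
-- From a run to a solution: advance every read on r to the matching write,
-- together with the moves of Receiver up to the next read on r.  Whatever is
-- read after a test in the resulting word is then read after that test in the
-- run, hence was written after it.
-- From a solution to a run: Receiver lags behind, reading only what has been
-- written; when a test is reached, the embedding of the whole rest and the one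
-- given by R′ allow to split the pending reads so that the first part embeds in
-- the contents of l and the rest in what is written after the test.
--
-- The reduction is programmed in a language of loops in which every expression
-- denotes a polynomial-time function by construction.

open import Data.Fin.Base using (Fin; zero; suc; toℕ; combine; _↑ˡ_; _↑ʳ_)
open import Data.Fin.Properties using (toℕ-combine; toℕ-↑ˡ; toℕ-↑ʳ; combine-injective)
open import Data.List.Base as List using (List; []; _∷_; [_]; _++_; _ʳ++_; concatMap; foldr; applyUpTo)
open import Data.List.Membership.Propositional using (_∈_; find; lose)
open import Data.List.Membership.Propositional.Properties
  using (∈-concatMap⁺; ∈-concatMap⁻; ∈-tabulate⁺; ∈-tabulate⁻)
open import Data.List.Properties
  using (foldr-∷ʳ; applyUpTo-∷ʳ; ++-ʳ++; ++-assoc; ++-identityʳ)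
open import Data.List.Relation.Binary.Pointwise using ([]; _∷_; Pointwise-≡⇒≡; ≡⇒Pointwise-≡)
open import Data.List.Relation.Binary.Sublist.Propositional
  using (_⊆_; []; _∷_; _∷ʳ_; minimum; ⊆-refl; ⊆-trans)
open import Data.List.Relation.Binary.Sublist.Propositional.Properties using (++⁺ˡ; ++⁺)
open import Data.List.Relation.Binary.Suffix.Heterogeneous using (Suffix; here; there)
open import Data.List.Relation.Unary.Any using (here; there)
open import Data.List.Relation.Unary.Any.Properties using (reverseAcc⁺; reverseAcc⁻)
open import Data.Nat.Base using (ℕ; zero; suc; _+_; _*_; _^_; _≤_; z≤n; s≤s; NonZero)
open import Data.Nat.Properties
open import Data.Nat.Solver using (module +-*-Solver)
open import Data.Product.Base using (_×_; _,_; ∃-syntax; proj₁; proj₂)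
open import Data.Sum.Base using (inj₁; inj₂)
import Data.Vec.Base as Vec
import Data.Vec.Properties as Vec
open import Function.Base using (_∘_)
open import Function.Bundles using (mk⇔; module Equivalence)
open import Relation.Binary.Construct.Closure.ReflexiveTransitive as Star using (Star; ε; _◅_; _◅◅_)
open import Relation.Binary.PropositionalEquality hiding ([_])
open import Relation.Nullary.Negation using (contradiction)

open import Defs

-- Polynomial time

infixl 6 _⊕_
infixl 7 _⊗_
infixl 8 _⟨_⟩

-- Substitution is a constructor because the second part of a sequential composition runs on a
-- result whose size is itself only polynomially bounded.
data Poly : Set where
  X   : Poly
  con : ℕ → Poly
  _⊕_ _⊗_ _⟨_⟩ : Poly → Poly → Poly

eval : Poly → ℕ → ℕ
eval X           n = n
eval (con c)     n = c
eval (P ⊕ Q)     n = eval P n + eval Q n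
eval (P ⊗ Q)     n = eval P n * eval Q n
eval (P ⟨ Q ⟩)   n = eval P (eval Q n)

eval-mono : ∀ P {m n} → m ≤ n → eval P m ≤ eval P n
eval-mono X           m≤n = m≤n
eval-mono (con c)     m≤n = ≤-refl
eval-mono (P ⊕ Q)     m≤n = +-mono-≤ (eval-mono P m≤n) (eval-mono Q m≤n)
eval-mono (P ⊗ Q)     m≤n = *-mono-≤ (eval-mono P m≤n) (eval-mono Q m≤n)
eval-mono (P ⟨ Q ⟩)   m≤n = eval-mono P (eval-mono Q m≤n)

^-distribʳ-* : ∀ e m n → (m * n) ^ e ≡ m ^ e * n ^ e
^-distribʳ-* zero    m n = refl
^-distribʳ-* (suc e) m n =
  trans (cong (m * n *_) (^-distribʳ-* e m n)) ([m*n]*[o*p]≡[m*o]*[n*p] m n (m ^ e) (n ^ e))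

-- For nonzero `n` powers grow with the exponent. The coefficient is a successor so that in the case
-- of substitution `suc c′ * n ^ e′` is nonzero and the bound for `P` applies to it.
eval-≤-monomial : ∀ P → ∃[ c ] ∃[ e ] ∀ n .{{_ : NonZero n}} → eval P n ≤ suc c * n ^ e
eval-≤-monomial X = 0 , 1 , λ n → ≤-reflexive (sym (trans (*-identityˡ (n ^ 1)) (^-identityʳ n)))
eval-≤-monomial (con c) = c , 0 , λ n → ≤-trans (n≤1+n c) (≤-reflexive (sym (*-identityʳ (suc c))))
eval-≤-monomial (P ⊕ Q) with eval-≤-monomial P | eval-≤-monomial Q
... | c , e , P≤ | c′ , e′ , Q≤ = c + suc c′ , e + e′ , λ n → begin
  eval P n + eval Q n                             ≤⟨ +-mono-≤ (P≤ n) (Q≤ n) ⟩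
  suc c * n ^ e + suc c′ * n ^ e′                 ≤⟨ +-mono-≤
                                                       (*-monoʳ-≤ (suc c) (^-monoʳ-≤ n (m≤m+n e e′)))
                                                       (*-monoʳ-≤ (suc c′) (^-monoʳ-≤ n (m≤n+m e′ e))) ⟩
  suc c * n ^ (e + e′) + suc c′ * n ^ (e + e′)    ≡⟨ *-distribʳ-+ (n ^ (e + e′)) (suc c) (suc c′) ⟨
  (suc c + suc c′) * n ^ (e + e′)                 ∎
  where open ≤-Reasoning
eval-≤-monomial (P ⊗ Q) with eval-≤-monomial P | eval-≤-monomial Q
... | c , e , P≤ | c′ , e′ , Q≤ = c′ + c * suc c′ , e + e′ , λ n → begin
  eval P n * eval Q n                     ≤⟨ *-mono-≤ (P≤ n) (Q≤ n) ⟩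
  suc c * n ^ e * (suc c′ * n ^ e′)       ≡⟨ [m*n]*[o*p]≡[m*o]*[n*p] (suc c) (n ^ e) (suc c′) (n ^ e′) ⟩
  suc c * suc c′ * (n ^ e * n ^ e′)       ≡⟨ cong (suc c * suc c′ *_) (^-distribˡ-+-* n e e′) ⟨
  suc c * suc c′ * n ^ (e + e′)           ∎
  where open ≤-Reasoning
eval-≤-monomial (P ⟨ Q ⟩) with eval-≤-monomial P | eval-≤-monomial Q
... | c , e , P≤ | c′ , e′ , Q≤ =
  let C = suc c * suc c′ ^ e in
  C , e′ * e , λ n →
  let nonZero = m*n≢0 (suc c′) (n ^ e′) {{_}} {{m^n≢0 n e′}} in begin
  eval P (eval Q n)                       ≤⟨ eval-mono P (Q≤ n) ⟩
  eval P (suc c′ * n ^ e′)                ≤⟨ P≤ (suc c′ * n ^ e′) {{nonZero}} ⟩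
  suc c * (suc c′ * n ^ e′) ^ e           ≡⟨ cong (suc c *_) (^-distribʳ-* e (suc c′) (n ^ e′)) ⟩
  suc c * (suc c′ ^ e * (n ^ e′) ^ e)     ≡⟨ *-assoc (suc c) (suc c′ ^ e) ((n ^ e′) ^ e) ⟨
  C * (n ^ e′) ^ e                        ≡⟨ cong (C *_) (^-*-assoc n e′ e) ⟩
  C * n ^ (e′ * e)                        ≤⟨ *-monoˡ-≤ (n ^ (e′ * e)) (n≤1+n C) ⟩
  suc C * n ^ (e′ * e)                    ∎
  where open ≤-Reasoning

eval-≤-power : ∀ P → ∃[ k ] ∀ n .{{_ : NonZero n}} → eval P n ≤ k * n ^ k + k
eval-≤-power P with eval-≤-monomial P
-- A single number has to serve as coefficient and as exponent, so it must be at least `suc c` and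
-- at least `e`.
... | c , e , P≤ = suc c + e , λ n → begin
  eval P n                                ≤⟨ P≤ n ⟩
  suc c * n ^ e                           ≤⟨ *-mono-≤ (m≤m+n (suc c) e) (^-monoʳ-≤ n (m≤n+m e (suc c))) ⟩
  (suc c + e) * n ^ (suc c + e)           ≤⟨ m≤m+n _ (suc c + e) ⟩
  (suc c + e) * n ^ (suc c + e) + (suc c + e) ∎
  where open ≤-Reasoning

-- The loop language and its compilation.

hdᵗ tlᵗ : Tree → Tree
hdᵗ leaf       = leaf
hdᵗ (node a b) = a
tlᵗ leaf       = leaf
tlᵗ (node a b) = b

ifᵗ : Tree → Tree → Tree → Tree
ifᵗ leaf       a b = b
ifᵗ (node _ _) a b = a

revAppᵗ : Tree → Tree → Tree
revAppᵗ leaf        acc = acc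
revAppᵗ (node x xs) acc = revAppᵗ xs (node x acc)

forᵗ : (Tree → Tree) → Tree → Tree → Tree
forᵗ g leaf        acc = acc
forᵗ g (node x xs) acc = forᵗ g xs (revAppᵗ (g (node x xs)) acc)

-- In for e b a the body b sees the environment together with the whole rest of
-- the list e; its results are pushed element by element onto a.  Since b does
-- not see what has been accumulated, sizes grow only additively, and every
-- expression takes polynomial time.
data Exp : Set where
  id nil hd tl  : Exp
  cons _⨾_      : Exp → Exp → Exp
  if_then_else_ : Exp → Exp → Exp → Exp
  for           : Exp → Exp → Exp → Exp

⟦_⟧ : Exp → Tree → Tree
⟦ id ⟧                 d = d
⟦ nil ⟧                d = leaf
⟦ hd ⟧                 d = hdᵗ d
⟦ tl ⟧                 d = tlᵗ d
⟦ cons e f ⟧           d = node (⟦ e ⟧ d) (⟦ f ⟧ d)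
⟦ e ⨾ f ⟧              d = ⟦ f ⟧ (⟦ e ⟧ d)
⟦ if c then e else f ⟧ d = ifᵗ (⟦ c ⟧ d) (⟦ e ⟧ d) (⟦ f ⟧ d)
⟦ for e b a ⟧          d = forᵗ (λ s → ⟦ b ⟧ (node d s)) (⟦ e ⟧ d) (⟦ a ⟧ d)

push : Prog
push = cons (hd ⨾ tl) (cons (hd ⨾ hd) tl)

revApp : Prog
revApp = while hd push ⨾ tl

-- The loop state is `node d (node xs acc)`: environment, remaining list, accumulator. One round
-- runs `p` on `node d xs` and reverses its result onto `acc`.
forBody : Prog → Prog
forBody p = cons hd (cons (tl ⨾ hd ⨾ tl) (cons (cons hd (tl ⨾ hd) ⨾ p) (tl ⨾ tl) ⨾ revApp))

compile : Exp → Prog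
compile id                   = id
compile nil                  = nil
compile hd                   = hd
compile tl                   = tl
compile (cons e f)           = cons (compile e) (compile f)
compile (e ⨾ f)              = compile e ⨾ compile f
compile (if c then e else f) = if compile c then compile e else compile f
compile (for e b a)          =
  cons id (cons (compile e) (compile a)) ⨾ while (tl ⨾ hd) (forBody (compile b)) ⨾ tl ⨾ tl

-- Each construct is charged the size of its input, and `cons` adds the times of both components. So
-- time bounds also bound the sizes of intermediate results.
size≤time : ∀ {p d e t} → p ⊢ d ⇓ e [ t ] → size e ≤ t
size≤time id = ≤-refl
size≤time (nil {leaf}) = ≤-refl
size≤time (nil {node _ _}) = s≤s z≤n
size≤time hd-leaf = ≤-refl
size≤time (hd-node {a} {b}) = m≤n⇒m≤1+n (m≤m+n (size a) (size b))
size≤time tl-leaf = ≤-refl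
size≤time (tl-node {a} {b}) = m≤n⇒m≤1+n (m≤n+m (size b) (size a))
size≤time (cons {d = leaf} p q) = s≤s (+-mono-≤ (size≤time p) (size≤time q))
size≤time (cons {d = node a b} {i = i} p q) =
  s≤s (+-mono-≤ (m≤n⇒m≤o+n (size a + size b) (size≤time p)) (size≤time q))
size≤time (seq p q) = m≤n⇒m≤o+n _ (size≤time q)
size≤time (if-yes c p) = m≤n⇒m≤o+n _ (size≤time p)
size≤time (if-no c p) = m≤n⇒m≤o+n _ (size≤time p)
size≤time (stop c) = m≤m+n _ _
size≤time (loop c p w) = m≤n⇒m≤o+n _ (size≤time w)

-- Upper bounds on running times.

infix 4 _⊢_⇓_within_

_⊢_⇓_within_ : Prog → Tree → Tree → ℕ → Set
p ⊢ d ⇓ e within T = ∃[ t ] (p ⊢ d ⇓ e [ t ] × t ≤ T)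

size≤within : ∀ {p d e T} → p ⊢ d ⇓ e within T → size e ≤ T
size≤within (_ , p⇓ , t≤T) = ≤-trans (size≤time p⇓) t≤T

weaken : ∀ {p d e T T′} → T ≤ T′ → p ⊢ d ⇓ e within T → p ⊢ d ⇓ e within T′
weaken T≤T′ (t , p⇓ , t≤T) = t , p⇓ , ≤-trans t≤T T≤T′

module Within {d : Tree} {n : ℕ} (d≤n : size d ≤ n) where

  id-within : id ⊢ d ⇓ d within n
  id-within = _ , id , d≤n

  nil-within : nil ⊢ d ⇓ leaf within n
  nil-within = _ , nil , d≤n

  hd-within : hd ⊢ d ⇓ hdᵗ d within n
  hd-within = _ , hd⇓ d , d≤n
    where
    hd⇓ : ∀ d → hd ⊢ d ⇓ hdᵗ d [ size d ]
    hd⇓ leaf       = hd-leaf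
    hd⇓ (node a b) = hd-node

  tl-within : tl ⊢ d ⇓ tlᵗ d within n
  tl-within = _ , tl⇓ d , d≤n
    where
    tl⇓ : ∀ d → tl ⊢ d ⇓ tlᵗ d [ size d ]
    tl⇓ leaf       = tl-leaf
    tl⇓ (node a b) = tl-node

  cons-within : ∀ {p q a b i j} → p ⊢ d ⇓ a within i → q ⊢ d ⇓ b within j →
                cons p q ⊢ d ⇓ node a b within n + i + j
  cons-within (_ , p⇓ , ≤i) (_ , q⇓ , ≤j) = _ , cons p⇓ q⇓ , +-mono-≤ (+-mono-≤ d≤n ≤i) ≤j

  seq-within : ∀ {p q e f i j} → p ⊢ d ⇓ e within i → q ⊢ e ⇓ f within j →
               p ⨾ q ⊢ d ⇓ f within n + i + j
  seq-within (_ , p⇓ , ≤i) (_ , q⇓ , ≤j) = _ , seq p⇓ q⇓ , +-mono-≤ (+-mono-≤ d≤n ≤i) ≤j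

  -- Both branches are paid for, so that the bound does not depend on the outcome of the test.
  if-within : ∀ {c p q b e f i j k} → c ⊢ d ⇓ b within i → p ⊢ d ⇓ e within j → q ⊢ d ⇓ f within k →
              if c then p else q ⊢ d ⇓ ifᵗ b e f within n + i + (j + k)
  if-within {b = leaf} {j = j} (_ , c⇓ , ≤i) _ (_ , q⇓ , ≤k) =
    _ , if-no c⇓ q⇓ , +-mono-≤ (+-mono-≤ d≤n ≤i) (m≤n⇒m≤o+n j ≤k)
  if-within {b = node _ _} {k = k} (_ , c⇓ , ≤i) (_ , p⇓ , ≤j) _ =
    _ , if-yes c⇓ p⇓ , +-mono-≤ (+-mono-≤ d≤n ≤i) (m≤n⇒m≤n+o k ≤j)

  stop-within : ∀ {c p i} → c ⊢ d ⇓ leaf within i → while c p ⊢ d ⇓ d within n + i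
  stop-within (_ , c⇓ , ≤i) = _ , stop c⇓ , +-mono-≤ d≤n ≤i

  loop-within : ∀ {c p a b e f i j k} → c ⊢ d ⇓ node a b within i → p ⊢ d ⇓ e within j →
                while c p ⊢ e ⇓ f within k → while c p ⊢ d ⇓ f within n + i + j + k
  loop-within (_ , c⇓ , ≤i) (_ , p⇓ , ≤j) (_ , w⇓ , ≤k) =
    _ , loop c⇓ p⇓ w⇓ , +-mono-≤ (+-mono-≤ (+-mono-≤ d≤n ≤i) ≤j) ≤k

open Within

hdᵗ-≤ : ∀ d {n} → size d ≤ n → size (hdᵗ d) ≤ n
hdᵗ-≤ d d≤n = size≤within (hd-within d≤n)

tlᵗ-≤ : ∀ d {n} → size d ≤ n → size (tlᵗ d) ≤ n
tlᵗ-≤ d d≤n = size≤within (tl-within d≤n)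

size-revApp : ∀ xs acc → suc (size (revAppᵗ xs acc)) ≡ size xs + size acc
size-revApp leaf        acc = refl
size-revApp (node x xs) acc = trans (size-revApp xs (node x acc))
  (solve 3 (λ x xs acc → xs :+ (con 1 :+ (x :+ acc)) := con 1 :+ (x :+ xs) :+ acc)
         refl (size x) (size xs) (size acc))
  where open +-*-Solver

pushTime revAppTime : Poly → Poly
pushTime N   = N ⊕ (N ⊕ N ⊕ N) ⊕ (N ⊕ (N ⊕ N ⊕ N) ⊕ N)
revAppTime N = N ⊕ N ⊗ (N ⊕ N ⊕ pushTime N) ⊕ N

module _ (P : Poly) (k : ℕ) where
  private
    n = eval P k
    G = eval (P ⊕ P ⊕ pushTime P) k

  push-within : ∀ d → size d ≤ n →
    push ⊢ d ⇓ node (tlᵗ (hdᵗ d)) (node (hdᵗ (hdᵗ d)) (tlᵗ d)) within eval (pushTime P) k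
  push-within d ≤n =
    cons-within ≤n (seq-within ≤n (hd-within ≤n) (tl-within (hdᵗ-≤ d ≤n)))
      (cons-within ≤n (seq-within ≤n (hd-within ≤n) (hd-within (hdᵗ-≤ d ≤n))) (tl-within ≤n))

  -- Moving an element across preserves the size of the state, so each round costs at most `G`.
  -- There are fewer than `size xs` rounds, which leaves a share for the final failing test.
  while-push-within : ∀ xs acc → suc (size xs + size acc) ≤ n →
    while hd push ⊢ node xs acc ⇓ node leaf (revAppᵗ xs acc) within size xs * G
  while-push-within leaf acc ≤n =
    weaken (≤-trans (m≤m+n (n + n) _) (≤-reflexive (sym (*-identityˡ G))))
           (stop-within ≤n (hd-within ≤n))
  while-push-within (node x xs) acc ≤n =
    weaken (+-monoʳ-≤ G (*-monoˡ-≤ G (m≤n+m (size xs) (size x))))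
           (loop-within ≤n (hd-within ≤n) (push-within _ ≤n)
             (while-push-within xs (node x acc) (≤-trans (≤-reflexive same) ≤n)))
    where
    open +-*-Solver
    same : suc (size xs + size (node x acc)) ≡ suc (size (node x xs) + size acc)
    same = solve 3 (λ x xs acc → con 1 :+ (xs :+ (con 1 :+ (x :+ acc))) :=
                                 con 1 :+ (con 1 :+ (x :+ xs) :+ acc))
                 refl (size x) (size xs) (size acc)

  revApp-within : ∀ xs acc → suc (size xs + size acc) ≤ n →
    revApp ⊢ node xs acc ⇓ revAppᵗ xs acc within eval (revAppTime P) k
  revApp-within xs acc ≤n =
    seq-within ≤n
      (weaken (*-monoˡ-≤ G (≤-trans (m≤m+n (size xs) (size acc)) (<⇒≤ ≤n))) (while-push-within xs acc ≤n))
      (tl-within (≤-trans (s≤s (≤-reflexive (size-revApp xs acc))) ≤n))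


forBodyTime roundTime : Poly → Poly → Poly
forBodyTime N B =
  N ⊕ N ⊕ (N ⊕ (N ⊕ N ⊕ (N ⊕ N ⊕ N)) ⊕
    (N ⊕ (N ⊕ (N ⊕ (N ⊕ N ⊕ (N ⊕ N ⊕ N)) ⊕ B) ⊕ (N ⊕ N ⊕ N)) ⊕ revAppTime (N ⊕ B)))
roundTime N B = N ⊕ (N ⊕ N ⊕ N) ⊕ forBodyTime N B

-- `L` bounds the remaining list and `A` every accumulator, so by `room` all loop states have size
-- at most `eval N k`.
module _ (N B : Poly) (k : ℕ) {p : Prog} {d : Tree} {g : Tree → Tree} (L A : ℕ)
         (step : ∀ s → size s ≤ L → p ⊢ node d s ⇓ g s within eval B k)
         (room : 2 + size d + L + A ≤ eval N k) where
  private
    n = eval N k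
    b = eval B k
    G = eval (roundTime N B) k

  state-≤ : ∀ xs acc → size xs ≤ L → size acc + size xs * b ≤ A → size (node d (node xs acc)) ≤ n
  state-≤ xs acc xs≤L acc≤A = begin
    suc (size d + suc (size xs + size acc))
      ≡⟨ solve 3 (λ d xs acc → con 1 :+ (d :+ (con 1 :+ (xs :+ acc))) := con 2 :+ d :+ xs :+ acc)
               refl (size d) (size xs) (size acc) ⟩
    2 + size d + size xs + size acc
      ≤⟨ +-mono-≤ (+-monoʳ-≤ (2 + size d) xs≤L) (≤-trans (m≤m+n _ _) acc≤A) ⟩
    2 + size d + L + A
      ≤⟨ room ⟩
    n ∎
    where
    open ≤-Reasoning
    open +-*-Solver

  forBody-within : ∀ xs acc → size xs ≤ L → size (node d (node xs acc)) ≤ n →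
    forBody p ⊢ node d (node xs acc) ⇓ node d (node (tlᵗ xs) (revAppᵗ (g xs) acc))
      within eval (forBodyTime N B) k
  forBody-within xs acc xs≤L ≤n =
    cons-within ≤n (hd-within ≤n)
      (cons-within ≤n
        (seq-within ≤n (tl-within ≤n)
          (seq-within tl≤n (hd-within tl≤n) (tl-within (hdᵗ-≤ (node xs acc) tl≤n))))
        (seq-within ≤n
          (cons-within ≤n
            (seq-within ≤n (cons-within ≤n (hd-within ≤n) (seq-within ≤n (tl-within ≤n) (hd-within tl≤n)))
                           (step xs xs≤L))
            (seq-within ≤n (tl-within ≤n) (tl-within tl≤n)))
          (revApp-within (N ⊕ B) k (g xs) acc revApp-room)))
    where
    tl≤n = tlᵗ-≤ (node d (node xs acc)) ≤n
    revApp-room : suc (size (g xs) + size acc) ≤ n + b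
    revApp-room = begin
      suc (size (g xs) + size acc)   ≡⟨ cong suc (+-comm (size (g xs)) (size acc)) ⟩
      suc (size acc) + size (g xs)   ≤⟨ +-mono-≤ (≤-trans (s≤s (m≤n+m (size acc) (size xs))) tl≤n)
                                                 (size≤within (step xs xs≤L)) ⟩
      n + b                          ∎
      where open ≤-Reasoning

  -- The invariant is `size acc + size xs * b ≤ A`: a round enlarges `acc` by at most `b`, the time
  -- of the body, while `size xs` drops by at least one.
  while-forBody-within : ∀ xs acc → size xs ≤ L → size acc + size xs * b ≤ A →
    while (tl ⨾ hd) (forBody p) ⊢ node d (node xs acc) ⇓ node d (node leaf (forᵗ g xs acc))
      within size xs * G
  while-forBody-within leaf acc xs≤L acc≤A =
    weaken (≤-trans (m≤m+n _ _) (≤-reflexive (sym (*-identityˡ G))))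
           (stop-within ≤n (seq-within ≤n (tl-within ≤n) (hd-within (tlᵗ-≤ (node d (node leaf acc)) ≤n))))
    where ≤n = state-≤ leaf acc xs≤L acc≤A
  while-forBody-within (node x xs) acc xs≤L acc≤A =
    weaken (+-monoʳ-≤ G (*-monoˡ-≤ G (m≤n+m (size xs) (size x))))
      (loop-within ≤n (seq-within ≤n (tl-within ≤n) (hd-within (tlᵗ-≤ (node d (node (node x xs) acc)) ≤n)))
        (forBody-within (node x xs) acc xs≤L ≤n)
        (while-forBody-within xs acc′ (≤-trans (m≤n⇒m≤1+n (m≤n+m (size xs) (size x))) xs≤L) acc′≤A))
    where
    ≤n = state-≤ (node x xs) acc xs≤L acc≤A
    acc′ = revAppᵗ (g (node x xs)) acc
    acc′≤A : size acc′ + size xs * b ≤ A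
    acc′≤A = begin
      size acc′ + size xs * b
        ≤⟨ +-monoˡ-≤ (size xs * b)
             (≤-trans (n≤1+n _) (≤-reflexive (size-revApp (g (node x xs)) acc))) ⟩
      size (g (node x xs)) + size acc + size xs * b
        ≤⟨ +-monoˡ-≤ (size xs * b) (+-monoˡ-≤ (size acc) (size≤within (step (node x xs) xs≤L))) ⟩
      b + size acc + size xs * b
        ≡⟨ cong (_+ size xs * b) (+-comm b (size acc)) ⟩
      size acc + b + size xs * b
        ≡⟨ +-assoc (size acc) b (size xs * b) ⟩
      size acc + suc (size xs) * b
        ≤⟨ +-monoʳ-≤ (size acc) (*-monoˡ-≤ b (s≤s (m≤n+m (size xs) (size x)))) ⟩
      size acc + size (node x xs) * b
        ≤⟨ acc≤A ⟩
      A ∎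
      where open ≤-Reasoning

-- Time polynomials of expressions.

time : Exp → Poly
time id                   = X
time nil                  = X
time hd                   = X
time tl                   = X
time (cons e f)           = X ⊕ time e ⊕ time f
time (e ⨾ f)              = X ⊕ time e ⊕ time f ⟨ time e ⟩
time (if c then e else f) = X ⊕ time c ⊕ (time e ⊕ time f)
time (for e b a)          = X ⊕ (X ⊕ X ⊕ (X ⊕ time e ⊕ time a)) ⊕ (N ⊕ T ⊕ (T ⊕ T ⊕ T))
  -- `B` bounds the body, run on `node d s` with `s` no larger than the time of `e`; `A` bounds
  -- accumulators and `N` loop states. `T` bounds the time of the loop, hence also the size of its
  -- last state, on which the trailing `tl ⨾ tl` runs.
  module ForTime where
  B = time b ⟨ con 1 ⊕ X ⊕ time e ⟩
  A = time a ⊕ time e ⊗ B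
  N = con 2 ⊕ X ⊕ time e ⊕ A
  T = time e ⊗ roundTime N B

compile-within : ∀ e d → compile e ⊢ d ⇓ ⟦ e ⟧ d within eval (time e) (size d)
compile-within id d = id-within ≤-refl
compile-within nil d = nil-within ≤-refl
compile-within hd d = hd-within ≤-refl
compile-within tl d = tl-within ≤-refl
compile-within (cons e f) d = cons-within ≤-refl (compile-within e d) (compile-within f d)
compile-within (e ⨾ f) d =
  seq-within ≤-refl (compile-within e d)
    (weaken (eval-mono (time f) (size≤within (compile-within e d))) (compile-within f (⟦ e ⟧ d)))
compile-within (if c then e else f) d =
  if-within ≤-refl (compile-within c d) (compile-within e d) (compile-within f d)
compile-within (for e b a) d =
  seq-within ≤-refl
    (cons-within ≤-refl (id-within ≤-refl) (cons-within ≤-refl (compile-within e d) (compile-within a d)))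
    (seq-within (state-≤ N B k L A′ step ≤-refl xs acc xs≤L acc≤A) loops
      (seq-within end≤T (tl-within end≤T) (tl-within (tlᵗ-≤ (node d (node leaf (⟦ for e b a ⟧ d))) end≤T))))
  where
  open ForTime e b a
  k   = size d
  xs  = ⟦ e ⟧ d
  acc = ⟦ a ⟧ d
  L   = eval (time e) k
  A′  = eval A k
  xs≤L : size xs ≤ L
  xs≤L = size≤within (compile-within e d)
  acc≤A : size acc + size xs * eval B k ≤ A′
  acc≤A = +-mono-≤ (size≤within (compile-within a d)) (*-monoˡ-≤ (eval B k) xs≤L)
  step : ∀ s → size s ≤ L → compile b ⊢ node d s ⇓ ⟦ b ⟧ (node d s) within eval B k
  step s s≤L = weaken (eval-mono (time b) (s≤s (+-monoʳ-≤ k s≤L))) (compile-within b (node d s))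
  loops : while (tl ⨾ hd) (forBody (compile b)) ⊢ node d (node xs acc)
            ⇓ node d (node leaf (⟦ for e b a ⟧ d)) within eval T k
  loops = weaken (*-monoˡ-≤ (eval (roundTime N B) k) xs≤L)
                 (while-forBody-within N B k L A′ step ≤-refl xs acc xs≤L acc≤A)
  end≤T = size≤within loops

size-nonZero : ∀ d → NonZero (size d)
size-nonZero leaf       = _
size-nonZero (node _ _) = _

compile-poly : ∀ e → ∃[ k ] ∀ d → ∃[ t ] (compile e ⊢ d ⇓ ⟦ e ⟧ d [ t ] × t ≤ k * size d ^ k + k)
compile-poly e with eval-≤-power (time e)
... | k , ≤k = k , λ d → weaken (≤k (size d) {{size-nonZero d}}) (compile-within e d)

computes⇒PolyTime : ∀ P Q {f} e →
  (∀ x → ⟦ e ⟧ (Problem.encode P x) ≡ Problem.encode Q (f x)) → PolyTime P Q f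
computes⇒PolyTime P Q {f} e e≡f with k , within ← compile-poly e = compile e , k , λ x →
  subst (λ d → ∃[ t ] (compile e ⊢ encode x ⇓ d [ t ] × t ≤ k * size (encode x) ^ k + k))
        (e≡f x) (within (encode x))
  where open Problem P using (encode)

-- The reduction

module Reduction (I : ReachInstance) where
  open ReachInstance I

  Letter = Fin (2 + (m + m))
  State  = Fin (suc m * (n₁ * n₂))

  pattern testˡ  = zero
  pattern silent = suc zero
  pattern comm x = suc (suc x)

  wr rd : Fin m → Fin (m + m)
  wr x = x ↑ˡ m
  rd x = m ↑ʳ x

  -- The first component is zero if channel r is empty, and suc x if it holds x.
  state : Fin (suc m) → Fin n₁ → Fin n₂ → State
  state k p q = combine k (combine p q)

  -- This is the target component of a Sender rule and the source component of a Receiver rule.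
  -- Hence a state holding `x` can only be left by reading `x` on r.
  pending : Chan → Act m → Fin (suc m)
  pending r (msg x)  = suc x
  pending r (test _) = zero
  pending r ε        = zero
  pending l _        = zero

  -- Actions on r are silent because the automaton tracks that channel in its state.
  letter : (Fin m → Fin (m + m)) → Chan → Act m → Letter
  letter f r _        = silent
  letter f l (test _) = testˡ
  letter f l (msg x)  = comm (f x)
  letter f l ε        = silent

  sends : Rule n₁ m → List (State × Letter × State)
  sends (rule p c α p′) =
    List.tabulate λ q → state zero p q , letter wr c α , state (pending c α) p′ q

  receives : Rule n₂ m → List (State × Letter × State)
  receives (rule q c α q′) =
    List.tabulate λ p → state (pending c α) p q , letter rd c α , state zero p q′

  -- The order of the transitions is that in which the program finds them: its
  -- loops push their results onto an accumulator.
  scheduler : NFA (2 + (m + m))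
  scheduler = record
    { states  = suc m * (n₁ * n₂)
    ; initial = [ state zero p-in q-in ]
    ; final   = [ state zero p-fi q-fi ]
    ; trans   = concatMap sends Δ₁ ʳ++ (concatMap receives Δ₂ ʳ++ [])
    }

  selfLoop : Letter → Fin 2 × Letter × Fin 2
  selfLoop a = suc zero , a , suc zero

  startsWithTest : NFA (2 + (m + m))
  startsWithTest = record
    { states  = 2
    ; initial = [ zero ]
    ; final   = [ suc zero ]
    ; trans   = (zero , testˡ , suc zero) ∷ List.tabulate selfLoop
    }

  readWord writeWord : Morphism (2 + (m + m)) m
  readWord  = [] Vec.∷ [] Vec.∷ Vec.tabulate (λ _ → []) Vec.++ Vec.tabulate [_]
  writeWord = [] Vec.∷ [] Vec.∷ Vec.tabulate [_] Vec.++ Vec.tabulate (λ _ → [])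

  reduction : PEPInstance
  reduction = record
    { s  = 2 + (m + m)
    ; g  = m
    ; u  = readWord
    ; v  = writeWord
    ; R  = scheduler
    ; R′ = startsWithTest
    }

open Reduction using (reduction)

-- The program of the reduction

revAppᵗ-encList : ∀ {A : Set} (e : A → Tree) xs ys →
  revAppᵗ (encList e xs) (encList e ys) ≡ encList e (xs ʳ++ ys)
revAppᵗ-encList e []       ys = refl
revAppᵗ-encList e (x ∷ xs) ys = revAppᵗ-encList e xs (x ∷ ys)

-- Rounds depend only on the head of the rest. Pushing reverses the order both within and between
-- rounds, so the whole concatenation comes out reversed.
forᵗ-concatMap : ∀ {A B : Set} {g} (e : A → Tree) (e′ : B → Tree) (h : A → List B) →
  (∀ x s → g (node (e x) s) ≡ encList e′ (h x)) →
  ∀ xs ys → forᵗ g (encList e xs) (encList e′ ys) ≡ encList e′ (concatMap h xs ʳ++ ys)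
forᵗ-concatMap e e′ h g≡ []       ys = refl
forᵗ-concatMap {g = g} e e′ h g≡ (x ∷ xs) ys = begin
  forᵗ g (encList e xs) (revAppᵗ (g (node (e x) (encList e xs))) (encList e′ ys))
    ≡⟨ cong (λ t → forᵗ g (encList e xs) (revAppᵗ t (encList e′ ys))) (g≡ x (encList e xs)) ⟩
  forᵗ g (encList e xs) (revAppᵗ (encList e′ (h x)) (encList e′ ys))
    ≡⟨ cong (forᵗ g (encList e xs)) (revAppᵗ-encList e′ (h x) ys) ⟩
  forᵗ g (encList e xs) (encList e′ (h x ʳ++ ys))
    ≡⟨ forᵗ-concatMap e e′ h g≡ xs (h x ʳ++ ys) ⟩
  encList e′ (concatMap h xs ʳ++ (h x ʳ++ ys))
    ≡⟨ cong (encList e′) (++-ʳ++ (h x)) ⟨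
  encList e′ ((h x ++ concatMap h xs) ʳ++ ys) ∎
  where open ≡-Reasoning

-- The rests of `encℕ n` are the numbers from `n` down to 1. The value at 1 is pushed last and ends
-- up first, so index `i` is seen by the body as `suc i`.
forᵗ-encℕ : ∀ (t : Tree → Tree) n acc →
  forᵗ (λ s → node (t s) leaf) (encℕ n) acc ≡ foldr node acc (applyUpTo (t ∘ encℕ ∘ suc) n)
forᵗ-encℕ t zero    acc = refl
forᵗ-encℕ t (suc n) acc = begin
  forᵗ (λ s → node (t s) leaf) (encℕ n) (node (h n) acc)  ≡⟨ forᵗ-encℕ t n (node (h n) acc) ⟩
  foldr node (node (h n) acc) (applyUpTo h n)             ≡⟨ foldr-∷ʳ node acc (h n) (applyUpTo h n) ⟨
  foldr node acc (applyUpTo h n List.∷ʳ h n)              ≡⟨ cong (foldr node acc) (applyUpTo-∷ʳ h n) ⟩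
  foldr node acc (applyUpTo h (suc n))                    ∎
  where
  open ≡-Reasoning
  h = t ∘ encℕ ∘ suc

foldr-applyUpTo : ∀ {A : Set} (e : A → Tree) {n} (f : Fin n → A) (h : ℕ → Tree) →
  (∀ i → h (toℕ i) ≡ e (f i)) → ∀ ys →
  foldr node (encList e ys) (applyUpTo h n) ≡ encList e (List.tabulate f ++ ys)
foldr-applyUpTo e {zero}  f h h≡ ys = refl
foldr-applyUpTo e {suc n} f h h≡ ys =
  cong₂ node (h≡ zero) (foldr-applyUpTo e (f ∘ suc) (h ∘ suc) (h≡ ∘ suc) ys)

forᵗ-tabulate : ∀ {A : Set} (e : A → Tree) (t : Tree → Tree) {n} (f : Fin n → A) →
  (∀ i → t (encℕ (suc (toℕ i))) ≡ e (f i)) → ∀ ys →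
  forᵗ (λ s → node (t s) leaf) (encℕ n) (encList e ys) ≡ encList e (List.tabulate f ++ ys)
forᵗ-tabulate e t {n} f t≡ ys =
  trans (forᵗ-encℕ t n (encList e ys)) (foldr-applyUpTo e f (t ∘ encℕ ∘ suc) t≡ ys)

forᵗ-tabulate-[] : ∀ {A : Set} (e : A → Tree) (t : Tree → Tree) {n} (f : Fin n → A) →
  (∀ i → t (encℕ (suc (toℕ i))) ≡ e (f i)) →
  forᵗ (λ s → node (t s) leaf) (encℕ n) leaf ≡ encList e (List.tabulate f)
forᵗ-tabulate-[] e t f t≡ =
  trans (forᵗ-tabulate e t f t≡ []) (cong (encList e) (++-identityʳ (List.tabulate f)))

toList-tabulate : ∀ {A : Set} {n} (f : Fin n → A) → Vec.toList (Vec.tabulate f) ≡ List.tabulate f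
toList-tabulate {n = zero}  f = refl
toList-tabulate {n = suc n} f = cong (f zero ∷_) (toList-tabulate (f ∘ suc))

-- A unary number is a list of leaves, so pushing one number onto another adds them, and the loop
-- does so `j` times.
forᵗ-*+ : ∀ a j i → forᵗ (λ _ → encℕ a) (encℕ j) (encℕ i) ≡ encℕ (a * j + i)
forᵗ-*+ a zero    i = cong (λ c → encℕ (c + i)) (sym (*-zeroʳ a))
forᵗ-*+ a (suc j) i = begin
  go (revAppᵗ (encℕ a) (encℕ i))   ≡⟨ cong go (revAppᵗ-encℕ a i) ⟩
  go (encℕ (a + i))                ≡⟨ forᵗ-*+ a j (a + i) ⟩
  encℕ (a * j + (a + i))           ≡⟨ cong encℕ a*j+[a+i] ⟩
  encℕ (a * suc j + i)             ∎
  where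
  open ≡-Reasoning
  go = forᵗ (λ _ → encℕ a) (encℕ j)
  a*j+[a+i] : a * j + (a + i) ≡ a * suc j + i
  a*j+[a+i] = trans (sym (+-assoc (a * j) a i))
                    (cong (_+ i) (trans (+-comm (a * j) a) (sym (*-suc a j))))
  revAppᵗ-encℕ : ∀ a i → revAppᵗ (encℕ a) (encℕ i) ≡ encℕ (a + i)
  revAppᵗ-encℕ zero    i = refl
  revAppᵗ-encℕ (suc a) i = trans (revAppᵗ-encℕ a (suc i)) (cong encℕ (+-suc a i))

-- Expressions over encoded instances.

mulAdd : Exp → Exp → Exp → Exp
mulAdd a j i = for j (hd ⨾ a) i

⟦mulAdd⟧ : ∀ {a j i d a′ j′ i′} → ⟦ a ⟧ d ≡ encℕ a′ → ⟦ j ⟧ d ≡ encℕ j′ → ⟦ i ⟧ d ≡ encℕ i′ →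
           ⟦ mulAdd a j i ⟧ d ≡ encℕ (a′ * j′ + i′)
⟦mulAdd⟧ {a′ = a′} {j′} {i′} a≡ j≡ i≡ rewrite a≡ | j≡ | i≡ = forᵗ-*+ a′ j′ i′

one : Exp
one = cons nil nil

succ : Exp → Exp
succ = cons nil

-- Two nested uses of the formula `n * i + j` for the number that `combine` assigns to a pair.
stateᴱ : Exp → Exp → Exp → Exp → Exp → Exp
stateᴱ n₁ n₂ k p q = mulAdd (mulAdd n₁ n₂ nil) k (mulAdd n₂ p q)

mᴱ n₁ᴱ n₂ᴱ Δ₁ᴱ Δ₂ᴱ p-inᴱ p-fiᴱ q-inᴱ q-fiᴱ : Exp
mᴱ    = hd ⨾ hd
n₁ᴱ   = hd ⨾ tl ⨾ hd
n₂ᴱ   = hd ⨾ tl ⨾ tl ⨾ hd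
Δ₁ᴱ   = hd ⨾ tl ⨾ tl ⨾ tl ⨾ hd
Δ₂ᴱ   = hd ⨾ tl ⨾ tl ⨾ tl ⨾ tl
p-inᴱ = tl ⨾ hd
p-fiᴱ = tl ⨾ tl ⨾ hd
q-inᴱ = tl ⨾ tl ⨾ tl ⨾ hd
q-fiᴱ = tl ⨾ tl ⨾ tl ⨾ tl

srcᴱ chanᴱ tagᴱ msgᴱ dstᴱ : Exp
srcᴱ  = hd
chanᴱ = tl ⨾ hd
tagᴱ  = tl ⨾ tl ⨾ hd ⨾ hd
msgᴱ  = tl ⨾ tl ⨾ hd ⨾ tl
dstᴱ  = tl ⨾ tl ⨾ tl

-- Channel r and tag 0 are encoded by `leaf`; testing a tag and then its `tl` tells tests, messages
-- and silent actions apart.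
pendingᴱ : Exp
pendingᴱ = if chanᴱ then nil else
           if tagᴱ then if tagᴱ ⨾ tl then nil else succ msgᴱ else nil

letterᴱ : Exp → Exp → Exp
letterᴱ ρ offset =
  if ρ ⨾ chanᴱ
  then if ρ ⨾ tagᴱ
       then if ρ ⨾ tagᴱ ⨾ tl then one else succ (succ (mulAdd one offset (ρ ⨾ msgᴱ)))
       else nil
  else one

encTransition : ∀ {k n} → Fin n × Fin k × Fin n → Tree
encTransition (p , a , q) = node (encFin p) (node (encFin a) (encFin q))

-- These refer to the environment node (node d s) s′ inside two loops, where s
-- starts with a rule and s′ counts down through the states of the other agent.
ruleᴱ otherᴱ : Exp
ruleᴱ  = hd ⨾ tl ⨾ hd
otherᴱ = tl ⨾ tl

stateᴱ′ : Exp → Exp → Exp → Exp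
stateᴱ′ = stateᴱ (hd ⨾ hd ⨾ n₁ᴱ) (hd ⨾ hd ⨾ n₂ᴱ)

sendᴱ receiveᴱ : Exp
sendᴱ =
  cons (stateᴱ′ nil (ruleᴱ ⨾ srcᴱ) otherᴱ)
  (cons (letterᴱ ruleᴱ nil)
        (stateᴱ′ (ruleᴱ ⨾ pendingᴱ) (ruleᴱ ⨾ dstᴱ) otherᴱ))
receiveᴱ =
  cons (stateᴱ′ (ruleᴱ ⨾ pendingᴱ) otherᴱ (ruleᴱ ⨾ srcᴱ))
  (cons (letterᴱ ruleᴱ (hd ⨾ hd ⨾ mᴱ))
        (stateᴱ′ nil otherᴱ (ruleᴱ ⨾ dstᴱ)))

transᴱ schedulerᴱ startsWithTestᴱ lettersᴱ reductionᴱ : Exp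
tableᴱ : Exp → Exp → Exp

transᴱ =
  for Δ₁ᴱ (for (hd ⨾ n₂ᴱ) (cons sendᴱ nil) nil)
  (for Δ₂ᴱ (for (hd ⨾ n₁ᴱ) (cons receiveᴱ nil) nil)
  nil)

schedulerᴱ =
  cons (mulAdd (succ mᴱ) (mulAdd n₁ᴱ n₂ᴱ nil) nil)
  (cons (cons (stateᴱ n₁ᴱ n₂ᴱ nil p-inᴱ q-inᴱ) nil)
  (cons (cons (stateᴱ n₁ᴱ n₂ᴱ nil p-fiᴱ q-fiᴱ) nil)
        transᴱ))

startsWithTestᴱ =
  cons (succ one)
  (cons (cons nil nil)
  (cons (cons one nil)
  (cons (cons nil (cons nil one))
        (for lettersᴱ (cons (cons one (cons (tl ⨾ tl) one)) nil) nil))))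

tableᴱ b b′ = cons nil (cons nil (for mᴱ (cons b nil) (for mᴱ (cons b′ nil) nil)))

lettersᴱ = succ (succ (mulAdd one mᴱ mᴱ))

reductionᴱ =
  cons lettersᴱ
  (cons mᴱ
  (cons (tableᴱ nil wordᴱ)
  (cons (tableᴱ wordᴱ nil)
  (cons schedulerᴱ startsWithTestᴱ))))
  where wordᴱ = cons (tl ⨾ tl) nil

-- Evaluation of the program on encoded instances.

module _ (I : ReachInstance) where
  open ReachInstance I
  open Reduction I hiding (reduction)

  private d = encReach I

  ⟦stateᴱ⟧ : ∀ {e₁ e₂ k p q d} {k′ : Fin (suc m)} {p′ : Fin n₁} {q′ : Fin n₂} →
    ⟦ e₁ ⟧ d ≡ encℕ n₁ → ⟦ e₂ ⟧ d ≡ encℕ n₂ →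
    ⟦ k ⟧ d ≡ encFin k′ → ⟦ p ⟧ d ≡ encFin p′ → ⟦ q ⟧ d ≡ encFin q′ →
    ⟦ stateᴱ e₁ e₂ k p q ⟧ d ≡ encFin (state k′ p′ q′)
  ⟦stateᴱ⟧ {e₁} {e₂} {k} {p} {q} {d} {k′} {p′} {q′} e₁≡ e₂≡ k≡ p≡ q≡ =
    trans (⟦mulAdd⟧ {mulAdd e₁ e₂ nil} {k} {mulAdd e₂ p q} {d}
            (trans (⟦mulAdd⟧ {e₁} {e₂} {nil} {d} {i′ = 0} e₁≡ e₂≡ refl) (cong encℕ (+-identityʳ _)))
            k≡
            (trans (⟦mulAdd⟧ {e₂} {p} {q} {d} e₂≡ p≡ q≡) (cong encℕ (sym (toℕ-combine p′ q′)))))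
          (cong encℕ (sym (toℕ-combine k′ (combine p′ q′))))

  ⟦pendingᴱ⟧ : ∀ {n} (p : Fin n) c α p′ → ⟦ pendingᴱ ⟧ (encRule (rule p c α p′)) ≡ encFin (pending c α)
  ⟦pendingᴱ⟧ p r (test _) p′ = refl
  ⟦pendingᴱ⟧ p r (msg x)  p′ = refl
  ⟦pendingᴱ⟧ p r ε        p′ = refl
  ⟦pendingᴱ⟧ p l _        p′ = refl

  -- The offset `k` is 0 for `wr` and `m` for `rd`, so both agents are covered.
  ⟦letterᴱ⟧ : ∀ {n} (p : Fin n) c α p′ {ρ o d f k} →
    ⟦ ρ ⟧ d ≡ encRule (rule p c α p′) → ⟦ o ⟧ d ≡ encℕ k → (∀ x → toℕ (f x) ≡ k + toℕ x) →
    ⟦ letterᴱ ρ o ⟧ d ≡ encFin (letter f c α)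
  ⟦letterᴱ⟧ p r α        p′ ρ≡ o≡ f≡ rewrite ρ≡ = refl
  ⟦letterᴱ⟧ p l (test _) p′ ρ≡ o≡ f≡ rewrite ρ≡ = refl
  ⟦letterᴱ⟧ p l (msg x)  p′ {k = k} ρ≡ o≡ f≡ rewrite ρ≡ | o≡ =
    cong (node leaf ∘ node leaf)
      (trans (forᵗ-*+ 1 k (toℕ x)) (cong encℕ (trans (cong (_+ toℕ x) (*-identityˡ k)) (sym (f≡ x)))))
  ⟦letterᴱ⟧ p l ε        p′ ρ≡ o≡ f≡ rewrite ρ≡ = refl

  ⟦stateᴱ′⟧ : ∀ {k p q s s′} {k′ : Fin (suc m)} {p′ : Fin n₁} {q′ : Fin n₂} →
    let env = node (node d s) s′ in
    ⟦ k ⟧ env ≡ encFin k′ → ⟦ p ⟧ env ≡ encFin p′ → ⟦ q ⟧ env ≡ encFin q′ →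
    ⟦ stateᴱ′ k p q ⟧ env ≡ encFin (state k′ p′ q′)
  ⟦stateᴱ′⟧ {k} {p} {q} {s} {s′} =
    ⟦stateᴱ⟧ {hd ⨾ hd ⨾ n₁ᴱ} {hd ⨾ hd ⨾ n₂ᴱ} {k} {p} {q} {node (node d s) s′} refl refl

  ⟦sends⟧ : ∀ ρ s →
    ⟦ for (hd ⨾ n₂ᴱ) (cons sendᴱ nil) nil ⟧ (node d (node (encRule ρ) s)) ≡
    encList encTransition (sends ρ)
  ⟦sends⟧ ρ@(rule p c α p′) s =
    forᵗ-tabulate-[] encTransition (λ s′ → ⟦ sendᴱ ⟧ (node (node d s₁) s′)) f transition
    where
    s₁ = node (encRule ρ) s
    f = λ q → state zero p q , letter wr c α , state (pending c α) p′ q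
    transition : ∀ q → ⟦ sendᴱ ⟧ (node (node d s₁) (encℕ (suc (toℕ q)))) ≡ encTransition (f q)
    transition q =
      cong₂ node (⟦stateᴱ′⟧ {k = nil} {ruleᴱ ⨾ srcᴱ} {otherᴱ} {s = s₁} {s₂} {zero} {p} {q} refl refl refl)
      (cong₂ node (⟦letterᴱ⟧ p c α p′ {ruleᴱ} {nil} {d₂} {wr} {0} refl refl (λ x → toℕ-↑ˡ x m))
        (⟦stateᴱ′⟧ {k = ruleᴱ ⨾ pendingᴱ} {ruleᴱ ⨾ dstᴱ} {otherᴱ} {s = s₁} {s₂} {pending c α} {p′} {q}
                  (⟦pendingᴱ⟧ p c α p′) refl refl))
      where
      s₂ = encℕ (suc (toℕ q))
      d₂ = node (node d s₁) s₂

  ⟦receives⟧ : ∀ ρ s →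
    ⟦ for (hd ⨾ n₁ᴱ) (cons receiveᴱ nil) nil ⟧ (node d (node (encRule ρ) s)) ≡
    encList encTransition (receives ρ)
  ⟦receives⟧ ρ@(rule q c α q′) s =
    forᵗ-tabulate-[] encTransition (λ s′ → ⟦ receiveᴱ ⟧ (node (node d s₁) s′)) f transition
    where
    s₁ = node (encRule ρ) s
    f = λ p → state (pending c α) p q , letter rd c α , state zero p q′
    transition : ∀ p → ⟦ receiveᴱ ⟧ (node (node d s₁) (encℕ (suc (toℕ p)))) ≡ encTransition (f p)
    transition p =
      cong₂ node (⟦stateᴱ′⟧ {k = ruleᴱ ⨾ pendingᴱ} {otherᴱ} {ruleᴱ ⨾ srcᴱ} {s = s₁} {s₂} {pending c α} {p} {q}
                  (⟦pendingᴱ⟧ q c α q′) refl refl)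
      (cong₂ node (⟦letterᴱ⟧ q c α q′ {ruleᴱ} {hd ⨾ hd ⨾ mᴱ} {d₂} {rd} {m} refl refl (λ x → toℕ-↑ʳ m x))
        (⟦stateᴱ′⟧ {k = nil} {otherᴱ} {ruleᴱ ⨾ dstᴱ} {s = s₁} {s₂} {zero} {p} {q′} refl refl refl))
      where
      s₂ = encℕ (suc (toℕ p))
      d₂ = node (node d s₁) s₂

  ⟦transᴱ⟧ : ⟦ transᴱ ⟧ d ≡ encList encTransition (NFA.trans scheduler)
  ⟦transᴱ⟧ = trans
    (cong (forᵗ _ (encList encRule Δ₁)) (forᵗ-concatMap encRule encTransition receives ⟦receives⟧ Δ₂ []))
    (forᵗ-concatMap encRule encTransition sends ⟦sends⟧ Δ₁ (concatMap receives Δ₂ ʳ++ []))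

  ⟦schedulerᴱ⟧ : ⟦ schedulerᴱ ⟧ d ≡ encNFA scheduler
  ⟦schedulerᴱ⟧ = cong₂ node
    (trans (⟦mulAdd⟧ {succ mᴱ} {mulAdd n₁ᴱ n₂ᴱ nil} {nil} {d} {suc m} {i′ = 0} refl
              (⟦mulAdd⟧ {n₁ᴱ} {n₂ᴱ} {nil} {d} {i′ = 0} refl refl refl) refl)
           (cong encℕ (trans (+-identityʳ _) (cong (suc m *_) (+-identityʳ (n₁ * n₂))))))
    (cong₂ node (cong (λ t → node t leaf)
      (⟦stateᴱ⟧ {n₁ᴱ} {n₂ᴱ} {nil} {p-inᴱ} {q-inᴱ} {d} {zero} {p-in} {q-in} refl refl refl refl refl))
    (cong₂ node (cong (λ t → node t leaf)
      (⟦stateᴱ⟧ {n₁ᴱ} {n₂ᴱ} {nil} {p-fiᴱ} {q-fiᴱ} {d} {zero} {p-fi} {q-fi} refl refl refl refl refl))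
    ⟦transᴱ⟧))

  ⟦lettersᴱ⟧ : ⟦ lettersᴱ ⟧ d ≡ encℕ (2 + (m + m))
  ⟦lettersᴱ⟧ = cong (node leaf ∘ node leaf)
    (trans (forᵗ-*+ 1 m m) (cong (λ k → encℕ (k + m)) (*-identityˡ m)))

  ⟦startsWithTestᴱ⟧ : ⟦ startsWithTestᴱ ⟧ d ≡ encNFA startsWithTest
  ⟦startsWithTestᴱ⟧ =
    cong (node (encℕ 2) ∘ node (encList encℕ [ 0 ]) ∘ node (encList encℕ [ 1 ]) ∘
          node (node (encℕ 0) (node (encℕ 0) (encℕ 1))))
      (trans (cong (λ n → forᵗ (λ s → node (node (encℕ 1) (node (tlᵗ s) (encℕ 1))) leaf) n leaf) ⟦lettersᴱ⟧)
      (forᵗ-tabulate-[] encTransition (λ s → node (encℕ 1) (node (tlᵗ s) (encℕ 1))) selfLoop (λ _ → refl)))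

  ⟦tableᴱ⟧ : ∀ {b b′} (f f′ : Fin m → Word m) →
    (∀ i → ⟦ b ⟧ (node d (encℕ (suc (toℕ i)))) ≡ encWord (f i)) →
    (∀ i → ⟦ b′ ⟧ (node d (encℕ (suc (toℕ i)))) ≡ encWord (f′ i)) →
    ⟦ tableᴱ b b′ ⟧ d ≡ encMorphism ([] Vec.∷ [] Vec.∷ Vec.tabulate f Vec.++ Vec.tabulate f′)
  ⟦tableᴱ⟧ {b} {b′} f f′ b≡ b′≡ = cong (node leaf ∘ node leaf) (begin
    go b (go b′ leaf)
      ≡⟨ cong (go b) (forᵗ-tabulate-[] encWord (λ s → ⟦ b′ ⟧ (node d s)) f′ b′≡) ⟩
    go b (encList encWord (List.tabulate f′))
      ≡⟨ forᵗ-tabulate encWord (λ s → ⟦ b ⟧ (node d s)) f b≡ (List.tabulate f′) ⟩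
    encList encWord (List.tabulate f ++ List.tabulate f′)
      ≡⟨ cong (encList encWord) (cong₂ _++_ (toList-tabulate f) (toList-tabulate f′)) ⟨
    encList encWord (Vec.toList (Vec.tabulate f) ++ Vec.toList (Vec.tabulate f′))
      ≡⟨ cong (encList encWord) (Vec.toList-++ (Vec.tabulate f) (Vec.tabulate f′)) ⟨
    encMorphism (Vec.tabulate f Vec.++ Vec.tabulate f′) ∎)
    where
    open ≡-Reasoning
    go : Exp → Tree → Tree
    go b = forᵗ (λ s → node (⟦ b ⟧ (node d s)) leaf) (encℕ m)

  ⟦reductionᴱ⟧ : ⟦ reductionᴱ ⟧ (encReach I) ≡ encPEP (reduction I)
  ⟦reductionᴱ⟧ =
    cong₂ node ⟦lettersᴱ⟧
    (cong (node (encℕ m))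
    (cong₂ node (⟦tableᴱ⟧ {nil} {cons (tl ⨾ tl) nil} (λ _ → []) [_] (λ _ → refl) (λ _ → refl))
    (cong₂ node (⟦tableᴱ⟧ {cons (tl ⨾ tl) nil} {nil} [_] (λ _ → []) (λ _ → refl) (λ _ → refl))
    (cong₂ node ⟦schedulerᴱ⟧ ⟦startsWithTestᴱ⟧))))

-- Correctness of the reduction

loses-⊆ : ∀ {m} {v v′ : Word m} → v′ ⊆ v → Star Loses v v′
loses-⊆ []         = ε
loses-⊆ (x ∷ʳ τ)   = here ◅ loses-⊆ τ
loses-⊆ (refl ∷ τ) = Star.gmap (_ ∷_) there (loses-⊆ τ)

⊆-loses : ∀ {m} {v v′ : Word m} → Loses v v′ → v′ ⊆ v
⊆-loses here       = _ ∷ʳ ⊆-refl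
⊆-loses (there ls) = refl ∷ ⊆-loses ls

-- Follow the embedding until `v` is used up; what is then left of `w` is `w₂`. If `w` is used up
-- first, `w₂` is empty and the second hypothesis takes over.
⊆-split-prefix : ∀ {A : Set} (w v : List A) {t v′} → w ++ t ⊆ v ++ v′ → t ⊆ v′ →
  ∃[ w₁ ] ∃[ w₂ ] (w ≡ w₁ ++ w₂ × w₁ ⊆ v × w₂ ++ t ⊆ v′)
⊆-split-prefix w       []      τ          t⊆ = [] , w , refl , [] , τ
⊆-split-prefix []      (y ∷ v) τ          t⊆ = [] , [] , refl , minimum _ , t⊆
⊆-split-prefix (x ∷ w) (y ∷ v) (.y ∷ʳ τ)  t⊆ with ⊆-split-prefix (x ∷ w) v τ t⊆
... | w₁ , w₂ , w≡ , w₁⊆ , w₂⊆ = w₁ , w₂ , w≡ , y ∷ʳ w₁⊆ , w₂⊆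
⊆-split-prefix (x ∷ w) (.x ∷ v) (refl ∷ τ) t⊆ with ⊆-split-prefix w v τ t⊆
... | w₁ , w₂ , refl , w₁⊆ , w₂⊆ = x ∷ w₁ , w₂ , refl , refl ∷ w₁⊆ , w₂⊆

module Correctness (I : ReachInstance) where
  open ReachInstance I
  open Reduction I hiding (reduction)
  open OnlyZ₁ˡ onlyZ₁ˡ

  -- Images of the letters and transitions of the automaton.

  reads writes : Letter → Word m
  reads  = Vec.lookup readWord
  writes = Vec.lookup writeWord

  U V : Word (2 + (m + m)) → Word m
  U = readWord ⟪_⟫
  V = writeWord ⟪_⟫

  reads-wr : ∀ x → reads (comm (wr x)) ≡ []
  reads-wr x = trans (Vec.lookup-++ˡ (Vec.tabulate _) _ x) (Vec.lookup∘tabulate _ x)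

  reads-rd : ∀ x → reads (comm (rd x)) ≡ [ x ]
  reads-rd x = trans (Vec.lookup-++ʳ (Vec.tabulate {n = m} (λ _ → [])) (Vec.tabulate [_]) x)
                     (Vec.lookup∘tabulate [_] x)

  writes-wr : ∀ x → writes (comm (wr x)) ≡ [ x ]
  writes-wr x = trans (Vec.lookup-++ˡ (Vec.tabulate [_]) _ x) (Vec.lookup∘tabulate [_] x)

  writes-rd : ∀ x → writes (comm (rd x)) ≡ []
  writes-rd x = trans (Vec.lookup-++ʳ (Vec.tabulate [_]) (Vec.tabulate _) x) (Vec.lookup∘tabulate _ x)

  state-injective : ∀ {k k′ p p′ q q′} → state k p q ≡ state k′ p′ q′ → k ≡ k′ × p ≡ p′ × q ≡ q′
  state-injective {k} {k′} {p} {p′} {q} {q′} eq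
    with refl , eq′ ← combine-injective k (combine p q) k′ (combine p′ q′) eq
    = refl , combine-injective p q p′ q′ eq′

  Place : Set
  Place = Fin (suc m) × Fin n₁ × Fin n₂

  data Transition : Place → Letter → Place → Set where
    sending   : ∀ {p c α p′} → rule p c α p′ ∈ Δ₁ → ∀ q →
                Transition (zero , p , q) (letter wr c α) (pending c α , p′ , q)
    receiving : ∀ {q c α q′} → rule q c α q′ ∈ Δ₂ → ∀ p →
                Transition (pending c α , p , q) (letter rd c α) (zero , p , q′)

  trans-∈⁺ : ∀ {k p q a k′ p′ q′} → Transition (k , p , q) a (k′ , p′ , q′) →
             (state k p q , a , state k′ p′ q′) ∈ NFA.trans scheduler
  trans-∈⁺ (sending ρ∈ q) =
    reverseAcc⁺ _ (concatMap sends Δ₁)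
      (inj₂ (∈-concatMap⁺ sends (lose ρ∈ (∈-tabulate⁺ q))))
  trans-∈⁺ (receiving ρ∈ p) =
    reverseAcc⁺ _ (concatMap sends Δ₁) (inj₁ (reverseAcc⁺ [] (concatMap receives Δ₂)
      (inj₂ (∈-concatMap⁺ receives (lose ρ∈ (∈-tabulate⁺ p))))))

  -- A path supplies its next state as a bare number, which has to be recognised as a triple before
  -- the path can be followed further.
  trans-∈⁻ : ∀ {k p q a s} → (state k p q , a , s) ∈ NFA.trans scheduler →
    ∃[ k′ ] ∃[ p′ ] ∃[ q′ ] (s ≡ state k′ p′ q′ × Transition (k , p , q) a (k′ , p′ , q′))
  trans-∈⁻ {k} {p} {q} t∈ with reverseAcc⁻ (concatMap receives Δ₂ ʳ++ []) (concatMap sends Δ₁) t∈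
  ... | inj₂ t∈s
    with rule p₀ c α p′ , ρ∈ , t∈ρ ← find (∈-concatMap⁻ sends {xs = Δ₁} t∈s)
    with q₀ , eq ← ∈-tabulate⁻ t∈ρ
    with refl , refl , refl ← state-injective {k} {zero} {p} {p₀} {q} {q₀} (cong proj₁ eq)
    with refl ← cong (proj₁ ∘ proj₂) eq
    = _ , _ , _ , cong (proj₂ ∘ proj₂) eq , sending ρ∈ q
  ... | inj₁ t∈r with reverseAcc⁻ [] (concatMap receives Δ₂) t∈r
  ...   | inj₂ t∈r′
    with rule q₀ c α q′ , ρ∈ , t∈ρ ← find (∈-concatMap⁻ receives {xs = Δ₂} t∈r′)
    with p₀ , eq ← ∈-tabulate⁻ t∈ρ
    with refl , refl , refl ← state-injective {k} {pending c α} {p} {p₀} {q} {q₀} (cong proj₁ eq)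
    with refl ← cong (proj₁ ∘ proj₂) eq
    = _ , _ , _ , cong (proj₂ ∘ proj₂) eq , receiving ρ∈ p

  -- Codirectness.

  Codirect : Word (2 + (m + m)) → Set
  Codirect σ = ∀ σ′ → Suffix _≡_ σ′ σ → σ′ ∈L startsWithTest → U σ′ ⊆ V σ′

  ∈L-startsWithTest : ∀ σ → testˡ ∷ σ ∈L startsWithTest
  ∈L-startsWithTest σ = zero , suc zero , here refl , here refl , here refl ∷ stay σ
    where
    stay : ∀ σ → Path startsWithTest (suc zero) σ (suc zero)
    stay []      = []
    stay (a ∷ σ) = there (∈-tabulate⁺ {f = selfLoop} a) ∷ stay σ

  ∈L-startsWithTest⁻ : ∀ {a σ} → a ∷ σ ∈L startsWithTest → a ≡ testˡ
  ∈L-startsWithTest⁻ (_ , _ , here refl , _ , here refl ∷ _) = refl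
  ∈L-startsWithTest⁻ (_ , _ , here refl , _ , there t∈ ∷ _) with () ← proj₂ (∈-tabulate⁻ {f = selfLoop} t∈)

  codirect-[] : Codirect []
  codirect-[] .[] (here []) _ = []

  codirect-tail : ∀ {a σ} → Codirect (a ∷ σ) → Codirect σ
  codirect-tail cd σ′ suf = cd σ′ (there suf)

  -- Every letter but `testˡ` is a successor, and no word starting with one is accepted by
  -- `startsWithTest`.
  codirect-suc : ∀ {a σ} → Codirect σ → Codirect (suc a ∷ σ)
  codirect-suc cd _ (here (refl ∷ _)) σ∈ = contradiction (∈L-startsWithTest⁻ σ∈) λ ()
  codirect-suc cd _ (there suf)       σ∈ = cd _ suf σ∈

  -- Both images of `testˡ` are empty, so the demand on the new suffix is just `U σ ⊆ V σ`.
  codirect-test : ∀ {σ} → U σ ⊆ V σ → Codirect σ → Codirect (testˡ ∷ σ)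
  codirect-test τ cd _ (here pw)   _  with refl ← Pointwise-≡⇒≡ pw = τ
  codirect-test τ cd _ (there suf) σ∈ = cd _ suf σ∈

  codirect-test⁻ : ∀ {σ} → Codirect (testˡ ∷ σ) → U σ ⊆ V σ
  codirect-test⁻ {σ} cd = cd (testˡ ∷ σ) (here (≡⇒Pointwise-≡ refl)) (∈L-startsWithTest σ)

  -- Moves of Receiver alone, consuming `u` on r and `w` on l, whatever else the channels contain.
  -- They describe the lag of Receiver in both directions of the proof.
  data Reads : Fin n₂ → Word m → Word m → Fin n₂ → Set where
    done  : ∀ {q} → Reads q [] [] q
    idle  : ∀ {q c q₁ u w q′} → rule q c ε q₁ ∈ Δ₂ → Reads q₁ u w q′ → Reads q u w q′
    fromʳ : ∀ {q x q₁ u w q′} → rule q r (msg x) q₁ ∈ Δ₂ → Reads q₁ u w q′ → Reads q (x ∷ u) w q′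
    fromˡ : ∀ {q x q₁ u w q′} → rule q l (msg x) q₁ ∈ Δ₂ → Reads q₁ u w q′ → Reads q u (x ∷ w) q′

  reads-++ : ∀ {q u w q₁ u′ w′ q′} → Reads q u w q₁ → Reads q₁ u′ w′ q′ → Reads q (u ++ u′) (w ++ w′) q′
  reads-++ done         ρs′ = ρs′
  reads-++ (idle ρ ρs)  ρs′ = idle ρ (reads-++ ρs ρs′)
  reads-++ (fromʳ ρ ρs) ρs′ = fromʳ ρ (reads-++ ρs ρs′)
  reads-++ (fromˡ ρ ρs) ρs′ = fromˡ ρ (reads-++ ρs ρs′)

  -- Channel r is read in order, so after the read of its last message `x` Receiver reads on l only.
  reads-split-∷ʳ : ∀ {q t w q′ x} u → Reads q t w q′ → t ≡ u ++ [ x ] →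
    ∃[ w₁ ] ∃[ w₂ ] ∃[ q₁ ] ∃[ q₂ ]
      (w ≡ w₁ ++ w₂ × Reads q u w₁ q₁ × rule q₁ r (msg x) q₂ ∈ Δ₂ × Reads q₂ [] w₂ q′)
  reads-split-∷ʳ []      done ()
  reads-split-∷ʳ (_ ∷ _) done ()
  reads-split-∷ʳ u (idle ρ ρs) eq
    with w₁ , w₂ , q₁ , q₂ , w≡ , ρs₁ , ρ∈ , ρs₂ ← reads-split-∷ʳ u ρs eq
    = w₁ , w₂ , q₁ , q₂ , w≡ , idle ρ ρs₁ , ρ∈ , ρs₂
  reads-split-∷ʳ u (fromˡ ρ ρs) eq
    with w₁ , w₂ , q₁ , q₂ , refl , ρs₁ , ρ∈ , ρs₂ ← reads-split-∷ʳ u ρs eq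
    = _ ∷ w₁ , w₂ , q₁ , q₂ , refl , fromˡ ρ ρs₁ , ρ∈ , ρs₂
  reads-split-∷ʳ [] (fromʳ ρ ρs) refl = [] , _ , _ , _ , refl , done , ρ , ρs
  reads-split-∷ʳ (x ∷ u) (fromʳ ρ ρs) refl
    with w₁ , w₂ , q₁ , q₂ , w≡ , ρs₁ , ρ∈ , ρs₂ ← reads-split-∷ʳ u ρs refl
    = w₁ , w₂ , q₁ , q₂ , w≡ , fromʳ ρ ρs₁ , ρ∈ , ρs₂

  -- The cut comes as soon as `w₁` has been read on l; the word on r is divided accordingly.
  reads-split-++ : ∀ {q u w q′} w₁ {w₂} → Reads q u w q′ → w ≡ w₁ ++ w₂ →
    ∃[ u₁ ] ∃[ u₂ ] ∃[ q₁ ] (u ≡ u₁ ++ u₂ × Reads q u₁ w₁ q₁ × Reads q₁ u₂ w₂ q′)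
  reads-split-++ []       ρs refl = [] , _ , _ , refl , done , ρs
  reads-split-++ (x ∷ w₁) done ()
  reads-split-++ (x ∷ w₁) (idle ρ ρs) eq
    with u₁ , u₂ , q₁ , u≡ , ρs₁ , ρs₂ ← reads-split-++ (x ∷ w₁) ρs eq
    = u₁ , u₂ , q₁ , u≡ , idle ρ ρs₁ , ρs₂
  reads-split-++ (x ∷ w₁) (fromʳ ρ ρs) eq
    with u₁ , u₂ , q₁ , refl , ρs₁ , ρs₂ ← reads-split-++ (x ∷ w₁) ρs eq
    = _ ∷ u₁ , u₂ , q₁ , refl , fromʳ ρ ρs₁ , ρs₂
  reads-split-++ (x ∷ w₁) (fromˡ ρ ρs) refl
    with u₁ , u₂ , q₁ , u≡ , ρs₁ , ρs₂ ← reads-split-++ w₁ ρs refl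
    = u₁ , u₂ , q₁ , u≡ , fromˡ ρ ρs₁ , ρs₂

  idle-step : ∀ {p q q′ u v} c → rule q c ε q′ ∈ Δ₂ → Step S (p , q , u , v) (p , q′ , u , v)
  idle-step r ρ = receiver ρ (skip , refl)
  idle-step l ρ = receiver ρ (refl , skip)

  reads-run : ∀ {p q u w q′ u′ v′} → Reads q u w q′ → Run S (p , q , u ++ u′ , w ++ v′) (p , q′ , u′ , v′)
  reads-run done                 = ε
  reads-run (idle {c = c} ρ ρs)  = idle-step c ρ ◅ reads-run ρs
  reads-run (fromʳ ρ ρs)         = receiver ρ (read , refl) ◅ reads-run ρs
  reads-run (fromˡ ρ ρs)         = receiver ρ (refl , read) ◅ reads-run ρs

  lose-run : ∀ {p q u v v′} → v′ ⊆ v → Run S (p , q , u , v) (p , q , u , v′)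
  lose-run τ = Star.gmap (λ v → _ , _ , _ , v) loss (loses-⊆ τ)

  -- From a run to a solution.

  Final : Fin n₁ → Fin n₂ → Word (2 + (m + m)) → Set
  Final p q σ = Path scheduler (state zero p q) σ (state zero p-fi q-fi)

  -- Receiver moves without reads on r are transitions of the automaton with r empty. They add `w`
  -- to the reads, nothing to the writes, and no test.
  flush : ∀ {p q w q′ σ} → Reads q [] w q′ → Final p q′ σ → Codirect σ →
    ∃[ σ′ ] (Final p q σ′ × U σ′ ≡ w ++ U σ × V σ′ ≡ V σ × Codirect σ′)
  flush done π cd = _ , π , refl , refl , cd
  flush {p} (idle {c = c} ρ ρs) π cd with σ′ , π′ , U≡ , V≡ , cd′ ← flush ρs π cd =
    silent ∷ σ′ , idle-transition c ρ ∷ π′ , U≡ , V≡ , codirect-suc cd′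
    where
    idle-transition : ∀ {q q₁} c → rule q c ε q₁ ∈ Δ₂ →
      (state zero p q , silent , state zero p q₁) ∈ NFA.trans scheduler
    idle-transition r ρ = trans-∈⁺ (receiving ρ p)
    idle-transition l ρ = trans-∈⁺ (receiving ρ p)
  flush {p} (fromˡ {x = x} ρ ρs) π cd with σ′ , π′ , U≡ , V≡ , cd′ ← flush ρs π cd =
    comm (rd x) ∷ σ′ , trans-∈⁺ (receiving ρ p) ∷ π′ ,
    cong₂ _++_ (reads-rd x) U≡ , cong₂ _++_ (writes-rd x) V≡ , codirect-suc cd′

  -- Receiver lags behind the automaton by the contents u of channel r: it still
  -- has to read u, and w on channel l, before the scheduled word σ begins.
  Schedule : Config S → Set
  Schedule (p , q , u , v) = ∃[ w ] ∃[ q′ ] ∃[ σ ]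
    (Reads q u w q′ × Final p q′ σ × w ++ U σ ⊆ v ++ V σ × Codirect σ)

  -- The run is followed backwards, since advancing a read on r to its write requires the later
  -- moves of Receiver.
  schedule-step : ∀ {K K′} → Step S K K′ → Schedule K′ → Schedule K
  schedule-step (sender {c = r} {test A} ρ _) _ with () ← proj₁ (tests₁ ρ)
  schedule-step (sender {c = r} {msg x} {K = u , v} ρ (write , refl)) (w , q′ , σ , ρs , π , τ , cd)
    -- The message written is the last one on r. Moves before its read stay pending, its write and
    -- read become two silent letters, and the later moves are scheduled right behind these.
    with w₁ , w₂ , q₁ , q₂ , refl , ρs₁ , ρ′ , ρs₂ ← reads-split-∷ʳ u ρs refl
    with σ′ , π′ , U≡ , V≡ , cd′ ← flush ρs₂ π cd
    = w₁ , q₁ , silent ∷ silent ∷ σ′ , ρs₁ ,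
      trans-∈⁺ (sending ρ q₁) ∷ trans-∈⁺ (receiving ρ′ _) ∷ π′ ,
      subst₂ _⊆_ (trans (++-assoc w₁ w₂ (U σ)) (cong (w₁ ++_) (sym U≡))) (cong (v ++_) (sym V≡)) τ ,
      codirect-suc (codirect-suc cd′)
  schedule-step (sender {c = r} {ε} ρ (skip , refl)) (w , q′ , σ , ρs , π , τ , cd) =
    w , q′ , silent ∷ σ , ρs , trans-∈⁺ (sending ρ q′) ∷ π , τ , codirect-suc cd
  schedule-step (sender {c = l} {test A} ρ (refl , test v∈A)) (w , q′ , σ , ρs , π , τ , cd)
    -- Since l is empty, `τ` embeds `w ++ U σ` in `V σ` alone; leaving out `w` gives the demand of
    -- the test.
    with refl ← Equivalence.to (proj₂ (tests₁ ρ) _) v∈A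
    = w , q′ , testˡ ∷ σ , ρs , trans-∈⁺ (sending ρ q′) ∷ π , τ ,
      codirect-test (⊆-trans (++⁺ˡ w ⊆-refl) τ) cd
  schedule-step (sender {c = l} {msg x} {K = u , v} ρ (refl , write)) (w , q′ , σ , ρs , π , τ , cd) =
    w , q′ , comm (wr x) ∷ σ , ρs , trans-∈⁺ (sending ρ q′) ∷ π ,
    subst₂ _⊆_ (cong (λ y → w ++ y ++ U σ) (sym (reads-wr x)))
               (trans (++-assoc v [ x ] (V σ)) (cong (λ y → v ++ y ++ V σ) (sym (writes-wr x)))) τ ,
    codirect-suc cd
  schedule-step (sender {c = l} {ε} ρ (refl , skip)) (w , q′ , σ , ρs , π , τ , cd) =
    w , q′ , silent ∷ σ , ρs , trans-∈⁺ (sending ρ q′) ∷ π , τ , codirect-suc cd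
  schedule-step (receiver {α = test A} ρ _) _ = contradiction ρ tests₂
  schedule-step (receiver {c = r} {msg x} ρ (read , refl)) (w , q′ , σ , ρs , sched) =
    w , q′ , σ , fromʳ ρ ρs , sched
  schedule-step (receiver {c = r} {ε} ρ (skip , refl)) (w , q′ , σ , ρs , sched) =
    w , q′ , σ , idle ρ ρs , sched
  schedule-step (receiver {c = l} {msg x} ρ (refl , read)) (w , q′ , σ , ρs , π , τ , cd) =
    x ∷ w , q′ , σ , fromˡ ρ ρs , π , refl ∷ τ , cd
  schedule-step (receiver {c = l} {ε} ρ (refl , skip)) (w , q′ , σ , ρs , sched) =
    w , q′ , σ , idle ρ ρs , sched
  schedule-step (loss ls) (w , q′ , σ , ρs , π , τ , cd) =
    w , q′ , σ , ρs , π , ⊆-trans τ (++⁺ (⊆-loses ls) ⊆-refl) , cd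

  schedule : ∀ {K} → Run S K (p-fi , q-fi , [] , []) → Schedule K
  schedule ε        = [] , q-fi , [] , done , [] , [] , codirect-[]
  schedule (s ◅ ss) = schedule-step s (schedule ss)

  solvable : E-E-Reachable I → PEP-Solvable (reduction I)
  solvable run
    with w , q′ , σ , ρs , π , τ , cd ← schedule run
    -- Initially r is empty, so all pending reads are on l and can be scheduled first.
    with σ′ , π′ , U≡ , V≡ , cd′ ← flush ρs π cd
    = σ′ , (_ , _ , here refl , here refl , π′) , subst₂ _⊆_ (sym U≡) (sym V≡) τ , cd′

  -- From a solution to a run.

  contents : Word m → Fin (suc m) → Word m
  contents u zero    = u
  contents u (suc x) = u ++ [ x ]

  -- Sender moves at once, while the moves of Receiver are only recorded in `Reads`; a message held
  -- by the automaton lies behind `u` on r. The ends of the path are given by equations because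
  -- states are values of `combine`, which cannot be matched directly.
  perform : ∀ k {s s′ σ p q q₀ u v w} → Path scheduler s σ s′ →
    s ≡ state k p q → s′ ≡ state zero p-fi q-fi →
    Reads q₀ u w q → w ++ U σ ⊆ v ++ V σ → Codirect σ →
    Run S (p , q₀ , contents u k , v) (p-fi , q-fi , [] , [])
  perform-step : ∀ {a s s′ σ k p q k′ p′ q′ q₀ u v w} → Transition (k , p , q) a (k′ , p′ , q′) →
    Path scheduler s σ s′ → s ≡ state k′ p′ q′ → s′ ≡ state zero p-fi q-fi →
    Reads q₀ u w q → w ++ reads a ++ U σ ⊆ v ++ writes a ++ V σ → Codirect (a ∷ σ) →
    Run S (p , q₀ , contents u k , v) (p-fi , q-fi , [] , [])

  perform k {p = p} {q} {v = v} {w} [] refl fin ρs τ cd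
    with refl , refl , refl ← state-injective {k} {zero} {p} {p-fi} {q} {q-fi} fin
    -- Losses reduce l to exactly `w`; then Receiver catches up and empties both channels.
    = lose-run (subst (w ++ [] ⊆_) (++-identityʳ v) τ) ◅◅
      subst (λ u → Run S (_ , _ , u , w ++ []) _) (++-identityʳ _) (reads-run ρs)
  perform k {p = p} {q} (t∈ ∷ π) refl fin ρs τ cd
    with _ , _ , _ , s≡ , tr ← trans-∈⁻ {k} {p} {q} t∈
    = perform-step tr π s≡ fin ρs τ cd

  perform-step (sending {c = r} {test A} ρ q) π s≡ fin ρs τ cd with () ← proj₁ (tests₁ ρ)
  perform-step (sending {c = r} {msg x} ρ q) π s≡ fin ρs τ cd
    = sender ρ (write , refl) ◅ perform (suc x) π s≡ fin ρs τ (codirect-tail cd)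
  perform-step (sending {c = r} {ε} ρ q) π s≡ fin ρs τ cd
    = sender ρ (skip , refl) ◅ perform zero π s≡ fin ρs τ (codirect-tail cd)
  perform-step {v = v} {w} (sending {c = l} {test A} ρ q) π s≡ fin ρs τ cd
    -- After losses l contains just `w₁`, and reading it empties l for the test. The reads `w₂` stay
    -- pending, as `τ′` embeds them with the rest in the later writes.
    with w₁ , w₂ , refl , w₁⊆v , τ′ ← ⊆-split-prefix w v τ (codirect-test⁻ cd)
    with u₁ , u₂ , q₁ , refl , ρs₁ , ρs₂ ← reads-split-++ w₁ ρs refl
    = lose-run w₁⊆v ◅◅
      subst (λ w → Run S (_ , _ , u₁ ++ u₂ , w) _) (++-identityʳ w₁) (reads-run ρs₁) ◅◅
      sender ρ (refl , test (Equivalence.from (proj₂ (tests₁ ρ) []) refl)) ◅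
      perform zero π s≡ fin ρs₂ τ′ (codirect-tail cd)
  perform-step {σ = σ} {v = v} {w} (sending {c = l} {msg x} ρ q) π s≡ fin ρs τ cd
    = sender ρ (refl , write) ◅
      perform zero π s≡ fin ρs
        (subst₂ _⊆_ (cong (λ y → w ++ y ++ U σ) (reads-wr x))
                    (trans (cong (λ y → v ++ y ++ V σ) (writes-wr x)) (sym (++-assoc v [ x ] (V σ)))) τ)
        (codirect-tail cd)
  perform-step (sending {c = l} {ε} ρ q) π s≡ fin ρs τ cd
    = sender ρ (refl , skip) ◅ perform zero π s≡ fin ρs τ (codirect-tail cd)
  perform-step (receiving {α = test A} ρ p) π s≡ fin ρs τ cd = contradiction ρ tests₂
  perform-step {σ = σ} {v = v} {w} (receiving {c = r} {msg x} ρ p) π s≡ fin ρs τ cd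
    -- The run makes no step here: `x`, so far held by the automaton, joins the messages that
    -- Receiver still has to read.
    = perform zero π s≡ fin (subst (λ w → Reads _ _ w _) (++-identityʳ w) (reads-++ ρs (fromʳ ρ done)))
        τ (codirect-tail cd)
  perform-step {σ = σ} {u = u} {v} {w} (receiving {c = l} {msg x} ρ p) π s≡ fin ρs τ cd
    = perform zero π s≡ fin (subst (λ u → Reads _ u _ _) (++-identityʳ u) (reads-++ ρs (fromˡ ρ done)))
        (subst₂ _⊆_ (trans (cong (λ y → w ++ y ++ U σ) (reads-rd x)) (sym (++-assoc w [ x ] (U σ))))
                    (cong (λ y → v ++ y ++ V σ) (writes-rd x)) τ)
        (codirect-tail cd)
  perform-step {u = u} {w = w} (receiving {c = r} {ε} ρ p) π s≡ fin ρs τ cd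
    = perform zero π s≡ fin
        (subst₂ (λ u w → Reads _ u w _) (++-identityʳ u) (++-identityʳ w) (reads-++ ρs (idle ρ done)))
        τ (codirect-tail cd)
  perform-step {u = u} {w = w} (receiving {c = l} {ε} ρ p) π s≡ fin ρs τ cd
    = perform zero π s≡ fin
        (subst₂ (λ u w → Reads _ u w _) (++-identityʳ u) (++-identityʳ w) (reads-++ ρs (idle ρ done)))
        τ (codirect-tail cd)

  reachable : PEP-Solvable (reduction I) → E-E-Reachable I
  reachable (σ , (_ , _ , here refl , here refl , π) , τ , cd) = perform zero π refl refl done τ cd

lemma7p2 : PolyReducible E-E-Reach[Z₁ˡ] PEP-partial-codir
lemma7p2 =
  reduction ,
  computes⇒PolyTime E-E-Reach[Z₁ˡ] PEP-partial-codir reductionᴱ ⟦reductionᴱ⟧ ,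
  λ I → mk⇔ (Correctness.solvable I) (Correctness.reachable I)
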